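{- Let $\alpha$ be a positive integer and $X\subseteq\mathbb{Z}_{2^\alpha}\setminus\{0\}$. Then the dihedrant $Dih(2^\alpha,X,X)$ is a (genuine) directed strongly regular graph if and only if $X=\psi_{\gamma}^{ -1}(H)$ for some $2\leqslant\gamma\leqslant\alpha$ and some subset $H\subseteq\mathbb{Z}_{2^\gamma}$ satisfying: (i) $H\uplus(-H)=(\mathbb{Z}_{2^\gamma}\setminus\{0\})\uplus\{2^{\gamma-1}\}$ (as multisets); (ii) $H\cap(2^{\gamma-1}+H)=\emptyset$.
   Context: For a positive integer $n$, $D_n=\langle x,a\mid x^n=1,\ a^2=1,\ ax=x^{ -1}a\rangle$. For $X,Y\subseteq\mathbb{Z}_n$ with $0\notin X$, $Dih(n,X,Y)$ denotes the Cayley digraph on $D_n$ with connection set $S=\{x^i:i\in X\}\cup\{x^ja:j\in Y\}$ (arc $g\to h$ iff $g^{ -1}h\in S$). A DSRG with parameters $(n,k,\mu,\lambda,t)$ is a digraph on $n$ vertices with adjacency matrix $A$ satisfying $AJ=JA=kJ$ and $A^2=tI+\lambda A+\mu(J-I-A)$; DSRGs are required to be genuine, i.e. $0<t<k$. $\psi_\gamma:\mathbb{Z}_{2^\alpha}\to\mathbb{Z}_{2^\gamma}$ is reduction mod $2^\gamma$, and $\psi_\gamma^{ -1}(H)$ the full preimage. $A\uplus B$ denotes multiset union (multiplicities add); $-H=\{ -h:h\in H\}$, $c+H=\{c+h:h\in H\}$. -}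

module Defs where

open import Data.Nat as ℕ using (ℕ; zero; suc; _^_; NonZero)
open import Data.Nat.Properties using (m^n≢0)
open import Data.Nat.DivMod using (_%_; m%n<n)
open import Data.Fin as Fin using (Fin; zero; suc; toℕ; fromℕ<; remQuot)
open import Data.Fin.Subset using (Subset; _∈_)
open import Data.Integer as ℤ using (ℤ; +_; 0ℤ; 1ℤ)
open import Data.Bool using (Bool; true; false; if_then_else_; not)
open import Data.Product using (_×_; _,_; ∃-syntax)
open import Relation.Binary.PropositionalEquality using (_≡_)
open import Relation.Nullary using (¬_; does)
open import Data.Vec using (lookup)

2^≢0 : ∀ α → NonZero (2 ^ α)
2^≢0 α = m^n≢0 2 α

ι : ∀ {m} .{{_ : NonZero m}} → ℕ → Fin m
ι {m} k = fromℕ< (m%n<n k m)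

_+ₘ_ : ∀ {m} .{{_ : NonZero m}} → Fin m → Fin m → Fin m
i +ₘ j = ι (toℕ i ℕ.+ toℕ j)

-ₘ_ : ∀ {m} .{{_ : NonZero m}} → Fin m → Fin m
-ₘ_ {m} i = ι (m ℕ.∸ toℕ i)

ψ : ∀ {α} γ → Fin (2 ^ α) → Fin (2 ^ γ)
ψ γ i = ι {{2^≢0 γ}} (toℕ i)

-- Dihedral group D_n: the element x^i a^e is represented by (i , e),
-- with e : Fin 2 (zero ↦ e = 0, suc zero ↦ e = 1).

D : ℕ → Set
D n = Fin n × Fin 2

-- (x^i a^e)(x^j a^f) = x^(i + (-1)^e j) a^(e+f)
_·_ : ∀ {n} .{{_ : NonZero n}} → D n → D n → D n
(i , zero)     · (j , f) = (i +ₘ j , f)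
(i , suc zero) · (j , zero)     = (i +ₘ (-ₘ j) , suc zero)
(i , suc zero) · (j , suc zero) = (i +ₘ (-ₘ j) , zero)

inv : ∀ {n} .{{_ : NonZero n}} → D n → D n
inv (i , zero)     = (-ₘ i , zero)
inv (i , suc zero) = (i , suc zero)

inS : ∀ {n} → Subset n → Subset n → D n → Bool
inS X Y (i , zero)     = lookup X i
inS X Y (i , suc zero) = lookup Y i

Digraph : ℕ → Set
Digraph N = Fin N → Fin N → Bool

∑ : ∀ {N} → (Fin N → ℤ) → ℤ
∑ {zero}  f = 0ℤ
∑ {suc N} f = f zero ℤ.+ ∑ (λ i → f (suc i))

Mat : ℕ → Set
Mat N = Fin N → Fin N → ℤ

adjMat : ∀ {N} → Digraph N → Mat N
adjMat G u v = if G u v then 1ℤ else 0ℤ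

Imat : ∀ {N} → Mat N
Imat u v = if does (u Fin.≟ v) then 1ℤ else 0ℤ

Jmat : ∀ {N} → Mat N
Jmat u v = 1ℤ

_⊗_ : ∀ {N} → Mat N → Mat N → Mat N
(A ⊗ B) u w = ∑ (λ v → A u v ℤ.* B v w)

-- A DSRG with parameters (N, k, μ, λ, t):
--   AJ = JA = kJ  and  A² = tI + λA + μ(J − I − A),  genuine: 0 < t < k.
record IsDSRGWith (N : ℕ) (G : Digraph N) (k μ lam t : ℕ) : Set where
  field
    AJ≡kJ : ∀ u w → (adjMat G ⊗ Jmat) u w ≡ + k ℤ.* Jmat u w
    JA≡kJ : ∀ u w → (Jmat ⊗ adjMat G) u w ≡ + k ℤ.* Jmat u w
    A²≡   : ∀ u w → (adjMat G ⊗ adjMat G) u w ≡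
              + t ℤ.* Imat u w ℤ.+ + lam ℤ.* adjMat G u w
                ℤ.+ + μ ℤ.* (Jmat u w ℤ.- Imat u w ℤ.- adjMat G u w)
    0<t   : 0 ℕ.< t
    t<k   : t ℕ.< k

IsDSRG : ∀ {N} → Digraph N → Set
IsDSRG {N} G = ∃[ k ] ∃[ μ ] ∃[ lam ] ∃[ t ] IsDSRGWith N G k μ lam t

-- The dihedrant Dih(n, X, Y): vertex v : Fin (n * 2) encodes the group
-- element remQuot 2 v : Fin n × Fin 2 (a bijection); arc g → h iff g⁻¹h ∈ S.

Dih : ∀ n .{{_ : NonZero n}} → Subset n → Subset n → Digraph (n ℕ.* 2)
Dih n X Y u v = inS X Y (inv (remQuot 2 u) · remQuot 2 v)

mult : ∀ {m} → Subset m → Fin m → ℕ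
mult H z = if lookup H z then 1 else 0

[_] : Bool → ℕ
[ b ] = if b then 1 else 0

module _ (γ : ℕ) where
  private
    instance
      nz : NonZero (2 ^ γ)
      nz = 2^≢0 γ

  half : Fin (2 ^ γ)
  half = ι (2 ^ (γ ℕ.∸ 1))

  0ᵧ : Fin (2 ^ γ)
  0ᵧ = ι 0

  -- (i)  H ⊎ (−H) = (Z_{2^γ} ∖ {0}) ⊎ {2^(γ−1)} as multisets:
  -- multiplicity of z on the left is [z ∈ H] + [−z ∈ H] (z ∈ −H ⇔ −z ∈ H),
  -- on the right [z ≠ 0] + [z = 2^(γ−1)].
  CondI : Subset (2 ^ γ) → Set
  CondI H = ∀ z → mult H z ℕ.+ mult H (-ₘ z)
                ≡ [ not (does (z Fin.≟ 0ᵧ)) ] ℕ.+ [ does (z Fin.≟ half) ]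

  CondII : Subset (2 ^ γ) → Set
  CondII H = ∀ h → h ∈ H → ¬ ((half +ₘ h) ∈ H)

{-# OPTIONS --safe #-}

-- Write X also for its group ring sum in ℤ[ℤ/n] and let E = X + X⁻, where X⁻ = Σ x⁻ⁱ (i ∈ X).  With
-- S = X(1 + a) one gets S² = XE(1 + a), so the DSRG equation says t = μ and XE = cX + μ(ℤ/n).
-- Adding its image under inversion gives E² = cE + 2μ(ℤ/n), whence
-- Σᵢ (Eᵢ − E_{i+w})² = −2c E_w for every w: c is negative and zeros of E are periods of E.
-- Let h = n/2.  If h ∉ X, then h is a period of E, hence of X, and one passes to ℤ/h.
-- If h ∈ X, no nonzero w is a period of E (its multiples contain h and E_h = 2 ≠ E₀), so E ≥ 1 off 0.
-- Put C = −c.  Counting gives a formula for C in terms of j = |X| − h, which rules out C odd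
-- 2-adically.  If C is even, E² ≡ E⁽²⁾ mod 2 makes E invariant under h off {0, h}; the sum of squares
-- for w = h then gives C = 2, and counting gives |X| = h.  So E is 1 off {0, h}, which is (i), and
-- XE = cX + μ(ℤ/n) becomes X + (h + X) = ℤ/n, which is (ii).
module Submission where

open import Defs
open import Algebra.Bundles using (AbelianGroup)
open import Data.Bool using (Bool; true; false; if_then_else_; not)
open import Data.Empty using (⊥; ⊥-elim)
open import Data.Fin as Fin using (Fin; zero; suc; toℕ; fromℕ<; remQuot; combine)
import Data.Fin.Properties as Finₚ
open import Data.Fin.Subset using (Subset; _∈_; _∉_)
open import Data.Integer as ℤ using (ℤ; +_; -[1+_]; +[1+_]; 0ℤ; 1ℤ; _+_; _*_; -_; _-_)
open import Data.Integer.DivMod using (_%ℕ_; _/ℕ_; n%ℕd<d; a≡a%ℕn+[a/ℕn]*n)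
import Data.Integer.Properties as ℤₚ
open import Data.Integer.Tactic.RingSolver using (solve-∀)
open import Data.Nat as ℕ using (ℕ; zero; suc; _≤_; _<_; _^_; z≤n; s≤s; NonZero)
open import Data.Nat.DivMod using (m%n<n; m<n⇒m%n≡m)
import Data.Nat.Properties as ℕₚ
import Data.Nat.Tactic.RingSolver as ℕ-Solver
open import Data.Product using (_×_; _,_; proj₁; proj₂; ∃-syntax)
open import Data.Sum using (_⊎_; inj₁; inj₂)
open import Data.Vec using (lookup; tabulate)
open import Data.Vec.Properties using ([]=⇒lookup; lookup⇒[]=; lookup∘tabulate)
open import Function.Bundles using (_⇔_; mk⇔; module Equivalence)
open import Relation.Binary using (tri<; tri≈; tri>)
open import Relation.Binary.PropositionalEquality using (_≡_; _≢_; refl; sym; trans; cong; cong₂; subst; subst₂; module ≡-Reasoning)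
open import Relation.Nullary using (does; yes; no)
open import Relation.Nullary.Decidable using (dec-true; dec-false)
open import Algebra.Properties.Group (AbelianGroup.group ℤₚ.+-0-abelianGroup) using (∙-cancelˡ; ∙-cancelʳ)

-- Sums over a period

-- Functions on ℤ/n are represented by n-periodic functions on ℤ, so that index arithmetic takes
-- place in the ring ℤ.
∑< : ℕ → (ℤ → ℤ) → ℤ
∑< zero    f = 0ℤ
∑< (suc n) f = ∑< n f + f (+ n)

Periodic : ∀ {A : Set} → ℕ → (ℤ → A) → Set
Periodic n f = ∀ z → f (z + + n) ≡ f z

+-congˡ : ∀ a {b c} → b ≡ c → a + b ≡ a + c
+-congˡ a = cong (λ b → a + b)

∑-cong< : ∀ n {f g} → (∀ i → i < n → f (+ i) ≡ g (+ i)) → ∑< n f ≡ ∑< n g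
∑-cong< zero    p = refl
∑-cong< (suc n) p =
  cong₂ _+_ (∑-cong< n (λ i i<n → p i (ℕₚ.m≤n⇒m≤1+n i<n))) (p n (ℕₚ.n<1+n n))

∑-cong : ∀ n {f g} → (∀ z → f z ≡ g z) → ∑< n f ≡ ∑< n g
∑-cong n p = ∑-cong< n (λ i _ → p (+ i))

+-interchange : ∀ a b c d → (a + b) + (c + d) ≡ (a + c) + (b + d)
+-interchange = solve-∀

∑-+ : ∀ n f g → ∑< n (λ z → f z + g z) ≡ ∑< n f + ∑< n g
∑-+ zero    f g = refl
∑-+ (suc n) f g = trans (cong (_+ (f (+ n) + g (+ n))) (∑-+ n f g))
                        (+-interchange (∑< n f) (∑< n g) (f (+ n)) (g (+ n)))

∑-*ˡ : ∀ n c f → ∑< n (λ z → c * f z) ≡ c * ∑< n f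
∑-*ˡ zero    c f = sym (ℤₚ.*-zeroʳ c)
∑-*ˡ (suc n) c f = trans (cong (_+ c * f (+ n)) (∑-*ˡ n c f))
                         (sym (ℤₚ.*-distribˡ-+ c (∑< n f) (f (+ n))))

∑-const : ∀ n c → ∑< n (λ _ → c) ≡ + n * c
∑-const zero    c = refl
∑-const (suc n) c = trans (cong (_+ c) (∑-const n c)) (lemma (+ n) c)
  where
  lemma : ∀ m c → m * c + c ≡ (1ℤ + m) * c
  lemma = solve-∀

∑-swap : ∀ m n (f : ℤ → ℤ → ℤ) →
         ∑< m (λ i → ∑< n (f i)) ≡ ∑< n (λ j → ∑< m (λ i → f i j))
∑-swap zero    n f = sym (trans (∑-const n 0ℤ) (ℤₚ.*-zeroʳ (+ n)))
∑-swap (suc m) n f = trans (cong (_+ ∑< n (f (+ m))) (∑-swap m n f))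
  (sym (∑-+ n (λ j → ∑< m (λ i → f i j)) (f (+ m))))

∑-front : ∀ n f → ∑< (suc n) f ≡ f 0ℤ + ∑< n (λ i → f (1ℤ + i))
∑-front zero    f = ℤₚ.+-comm 0ℤ (f 0ℤ)
∑-front (suc n) f = trans (cong (_+ f (+ suc n)) (∑-front n f))
  (ℤₚ.+-assoc (f 0ℤ) _ (f (+ suc n)))

∑-split : ∀ m n f → ∑< (m ℕ.+ n) f ≡ ∑< m f + ∑< n (λ i → f (+ m + i))
∑-split m zero    f rewrite ℕₚ.+-identityʳ m = sym (ℤₚ.+-identityʳ (∑< m f))
∑-split m (suc n) f rewrite ℕₚ.+-suc m n =
  trans (cong (_+ f (+ (m ℕ.+ n))) (∑-split m n f)) (ℤₚ.+-assoc (∑< m f) _ _)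

-- Both sides are the sum of f over 0, ..., n, because i ↦ n - i carries 0, ..., n-1 to n, ..., 1.
∑-reverse : ∀ n f → ∑< n (λ i → f (+ n - i)) + f 0ℤ ≡ ∑< n f + f (+ n)
∑-reverse zero    f = refl
∑-reverse (suc n) f = begin
  ∑< (suc n) (λ i → f (+ suc n - i)) + f 0ℤ
    ≡⟨ cong (_+ f 0ℤ) (∑-front n (λ i → f (+ suc n - i))) ⟩
  (f (+ suc n - 0ℤ) + ∑< n (λ i → f (+ suc n - (1ℤ + i)))) + f 0ℤ
    ≡⟨ cong (_+ f 0ℤ) (cong₂ _+_ (cong f (ℤₚ.+-identityʳ (+ suc n)))
         (∑-cong n (λ i → cong f (cancel (+ n) i)))) ⟩
  (f (+ suc n) + ∑< n (λ i → f (+ n - i))) + f 0ℤ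
    ≡⟨ ℤₚ.+-assoc (f (+ suc n)) _ (f 0ℤ) ⟩
  f (+ suc n) + (∑< n (λ i → f (+ n - i)) + f 0ℤ)
    ≡⟨ +-congˡ (f (+ suc n)) (∑-reverse n f) ⟩
  f (+ suc n) + ∑< (suc n) f
    ≡⟨ ℤₚ.+-comm (f (+ suc n)) _ ⟩
  ∑< (suc n) f + f (+ suc n) ∎
  where
  open ≡-Reasoning
  cancel : ∀ n i → (1ℤ + n) - (1ℤ + i) ≡ n - i
  cancel = solve-∀

∑-shift-suc : ∀ n f → Periodic n f → ∑< n (λ i → f (1ℤ + i)) ≡ ∑< n f
∑-shift-suc n f per = ∙-cancelˡ (f 0ℤ) _ _ (begin
  f 0ℤ + ∑< n (λ i → f (1ℤ + i)) ≡⟨ sym (∑-front n f) ⟩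
  ∑< n f + f (0ℤ + + n)           ≡⟨ +-congˡ (∑< n f) (per 0ℤ) ⟩
  ∑< n f + f 0ℤ                   ≡⟨ ℤₚ.+-comm (∑< n f) (f 0ℤ) ⟩
  f 0ℤ + ∑< n f                   ∎)
  where
  open ≡-Reasoning

periodic-shift : ∀ {A : Set} n (f : ℤ → A) w → Periodic n f → Periodic n (λ i → f (w + i))
periodic-shift n f w per z = trans (cong f (sym (ℤₚ.+-assoc w z (+ n)))) (per (w + z))

∑-shift-ℕ : ∀ n f k → Periodic n f → ∑< n (λ i → f (+ k + i)) ≡ ∑< n f
∑-shift-ℕ n f zero per = ∑-cong n (λ i → cong f (ℤₚ.+-identityˡ i))
∑-shift-ℕ n f (suc k) per = begin
  ∑< n (λ i → f (+ suc k + i))    ≡⟨ ∑-cong n (λ i → cong f (reassoc (+ k) i)) ⟩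
  ∑< n (λ i → f (+ k + (1ℤ + i))) ≡⟨ ∑-shift-suc n (λ i → f (+ k + i)) (periodic-shift n f (+ k) per) ⟩
  ∑< n (λ i → f (+ k + i))        ≡⟨ ∑-shift-ℕ n f k per ⟩
  ∑< n f                          ∎
  where
  open ≡-Reasoning
  reassoc : ∀ k i → (1ℤ + k) + i ≡ k + (1ℤ + i)
  reassoc = solve-∀

∑-shift : ∀ n f w → Periodic n f → ∑< n (λ i → f (w + i)) ≡ ∑< n f
∑-shift n f (+ k)    per = ∑-shift-ℕ n f k per
∑-shift n f -[1+ k ] per = begin
  ∑< n g                       ≡⟨ sym (∑-shift-ℕ n g (suc k) (periodic-shift n f -[1+ k ] per)) ⟩
  ∑< n (λ i → g (+ suc k + i)) ≡⟨ ∑-cong n (λ i → cong f (cancel (+ suc k) i)) ⟩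
  ∑< n f                       ∎
  where
  open ≡-Reasoning
  g : ℤ → ℤ
  g i = f (-[1+ k ] + i)
  cancel : ∀ k i → (- k) + (k + i) ≡ i
  cancel = solve-∀

∑-neg : ∀ n f → Periodic n f → ∑< n (λ i → f (- i)) ≡ ∑< n f
∑-neg n f per = ∙-cancelʳ (f 0ℤ) _ _ (begin
  ∑< n (λ i → f (- i)) + f 0ℤ     ≡⟨ cong (_+ f 0ℤ) (∑-cong n λ i → sym (trans (cong f (ℤₚ.+-comm (+ n) (- i))) (per (- i)))) ⟩
  ∑< n (λ i → f (+ n - i)) + f 0ℤ ≡⟨ ∑-reverse n f ⟩
  ∑< n f + f (0ℤ + + n)           ≡⟨ +-congˡ (∑< n f) (per 0ℤ) ⟩
  ∑< n f + f 0ℤ ∎)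
  where
  open ≡-Reasoning

∑-reflect : ∀ n f w → Periodic n f → ∑< n (λ i → f (w - i)) ≡ ∑< n f
∑-reflect n f w per =
  trans (∑-neg n (λ i → f (w + i)) (periodic-shift n f w per)) (∑-shift n f w per)

∑-mult : ∀ k m f → Periodic m f → ∑< (k ℕ.* m) f ≡ + k * ∑< m f
∑-mult zero    m f per = refl
∑-mult (suc k) m f per = begin
  ∑< (m ℕ.+ k ℕ.* m) f                            ≡⟨ ∑-split m (k ℕ.* m) f ⟩
  ∑< m f + ∑< (k ℕ.* m) (λ i → f (+ m + i))
    ≡⟨ +-congˡ (∑< m f) (∑-cong (k ℕ.* m) λ i → trans (cong f (ℤₚ.+-comm (+ m) i)) (per i)) ⟩
  ∑< m f + ∑< (k ℕ.* m) f                         ≡⟨ +-congˡ (∑< m f) (∑-mult k m f per) ⟩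
  ∑< m f + + k * ∑< m f                           ≡⟨ lemma (∑< m f) (+ k) ⟩
  + suc k * ∑< m f ∎
  where
  open ≡-Reasoning
  lemma : ∀ a k → a + k * a ≡ (1ℤ + k) * a
  lemma = solve-∀

∑-nonneg : ∀ n f → (∀ i → i < n → 0ℤ ℤ.≤ f (+ i)) → 0ℤ ℤ.≤ ∑< n f
∑-nonneg zero    f p = ℤₚ.≤-refl
∑-nonneg (suc n) f p =
  ℤₚ.+-mono-≤ (∑-nonneg n f (λ i i<n → p i (ℕₚ.m≤n⇒m≤1+n i<n))) (p n (ℕₚ.n<1+n n))

nonneg+nonneg≤0 : ∀ {a b} → 0ℤ ℤ.≤ a → 0ℤ ℤ.≤ b → a + b ℤ.≤ 0ℤ → a ℤ.≤ 0ℤ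
nonneg+nonneg≤0 {a} 0≤a 0≤b s =
  ℤₚ.≤-trans (subst (ℤ._≤ a + _) (ℤₚ.+-identityʳ a) (ℤₚ.+-monoʳ-≤ a 0≤b)) s

∑≤0⇒term≡0 : ∀ n f → (∀ i → i < n → 0ℤ ℤ.≤ f (+ i)) → ∑< n f ℤ.≤ 0ℤ →
             ∀ i → i < n → f (+ i) ≡ 0ℤ
∑≤0⇒term≡0 (suc n) f p s i i<1+n with ℕₚ.m≤n⇒m<n∨m≡n (ℕ.s≤s⁻¹ i<1+n)
... | inj₁ i<n = ∑≤0⇒term≡0 n f (λ j j<n → p j (ℕₚ.m≤n⇒m≤1+n j<n))
      (nonneg+nonneg≤0 (∑-nonneg n f (λ j j<n → p j (ℕₚ.m≤n⇒m≤1+n j<n))) (p n (ℕₚ.n<1+n n)) s) i i<n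
... | inj₂ refl = ℤₚ.≤-antisym
      (nonneg+nonneg≤0 (p n (ℕₚ.n<1+n n)) (∑-nonneg n f (λ j j<n → p j (ℕₚ.m≤n⇒m≤1+n j<n)))
        (subst (ℤ._≤ 0ℤ) (ℤₚ.+-comm (∑< n f) (f (+ n))) s))
      (p n i<1+n)

-- Translating by z moves the value at z to index 0 without changing the sum.
∑-nonneg-periodic≤0⇒≡0 : ∀ n f → 0 < n → Periodic n f → (∀ z → 0ℤ ℤ.≤ f z) → ∑< n f ℤ.≤ 0ℤ →
                          ∀ z → f z ≡ 0ℤ
∑-nonneg-periodic≤0⇒≡0 n f 0<n per p s z =
  trans (cong f (sym (ℤₚ.+-identityʳ z)))
    (∑≤0⇒term≡0 n (λ i → f (z + i)) (λ i _ → p (z + + i))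
      (subst (ℤ._≤ 0ℤ) (sym (∑-shift n f z per)) s) 0 0<n)

∑-head : ∀ n f → 0 < n → (∀ i → 0 < i → i < n → f (+ i) ≡ 0ℤ) → ∑< n f ≡ f 0ℤ
∑-head (suc zero)    f 0<n p = ℤₚ.+-identityˡ (f 0ℤ)
∑-head (suc (suc n)) f 0<n p =
  trans (cong₂ _+_ (∑-head (suc n) f (s≤s z≤n) (λ i 0<i i<n → p i 0<i (ℕₚ.m≤n⇒m≤1+n i<n)))
                   (p (suc n) (s≤s z≤n) (ℕₚ.n<1+n (suc n))))
        (ℤₚ.+-identityʳ (f 0ℤ))

∑-two-heads : ∀ h f → 0 < h → (∀ i → 0 < i → i < h → f (+ i) ≡ 0ℤ) →
              (∀ i → 0 < i → i < h → f (+ h + + i) ≡ 0ℤ) →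
              ∑< (h ℕ.+ h) f ≡ f 0ℤ + f (+ h)
∑-two-heads h f 0<h p q = trans (∑-split h h f) (cong₂ _+_ (∑-head h f 0<h p)
  (trans (∑-head h (λ i → f (+ h + i)) 0<h q) (cong f (ℤₚ.+-identityʳ (+ h)))))

-- The terms at i and -i pair off; in ℤ/2h only 0 and h are their own negatives. Modulo 2 this
-- leaves g(0) + g(h).
∑-even-periodic : ∀ h g → Periodic (h ℕ.+ h) g → (∀ z → g (- z) ≡ g z) →
                  ∑< (h ℕ.+ h) g ≡ + 2 * ∑< h g - g 0ℤ + g (+ h)
∑-even-periodic h g per even = begin
  ∑< (h ℕ.+ h) g ≡⟨ ∑-split h h g ⟩
  ∑< h g + ∑< h (λ i → g (+ h + i)) ≡⟨ +-congˡ (∑< h g) (∑-cong h fold) ⟩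
  ∑< h g + ∑< h (λ i → g (+ h - i)) ≡⟨ lemma (∑< h g) _ (g 0ℤ) (g (+ h)) (∑-reverse h g) ⟩
  + 2 * ∑< h g - g 0ℤ + g (+ h) ∎
  where
  open ≡-Reasoning
  ring₁ : ∀ h i → - (h + i) + (h + h) ≡ h - i
  ring₁ = solve-∀
  fold : ∀ i → g (+ h + i) ≡ g (+ h - i)
  fold i = trans (sym (even (+ h + i)))
    (trans (sym (per (- (+ h + i)))) (cong g (ring₁ (+ h) i)))
  ring₂ : ∀ s r a → s + r ≡ s + (r + a) - a
  ring₂ = solve-∀
  ring₃ : ∀ s a b → s + (s + b) - a ≡ + 2 * s - a + b
  ring₃ = solve-∀
  lemma : ∀ s r a b → r + a ≡ s + b → s + r ≡ + 2 * s - a + b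
  lemma s r a b e = trans (ring₂ s r a) (trans (cong (λ k → s + k - a) e) (ring₃ s a b))

-- Parity and powers of two

nonneg-* : ∀ {a b} → 0ℤ ℤ.≤ a → 0ℤ ℤ.≤ b → 0ℤ ℤ.≤ a * b
nonneg-* {+ m} {+ n} _ _ = subst (0ℤ ℤ.≤_) (ℤₚ.pos-* m n) (ℤ.+≤+ z≤n)

square-nonneg : ∀ a → 0ℤ ℤ.≤ a * a
square-nonneg (+ n)    = nonneg-* {+ n} {+ n} (ℤ.+≤+ z≤n) (ℤ.+≤+ z≤n)
square-nonneg -[1+ n ] = ℤ.+≤+ z≤n

square≡0⇒≡0 : ∀ a → a * a ≡ 0ℤ → a ≡ 0ℤ
square≡0⇒≡0 a e with ℤₚ.i*j≡0⇒i≡0∨j≡0 a e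
... | inj₁ p = p
... | inj₂ p = p

1≢2* : ∀ w → 1ℤ ≢ + 2 * w
1≢2* (+ zero)  ()
1≢2* +[1+ n ] e with trans (ℤₚ.+-injective e) (cong suc (ℕₚ.+-suc n (n ℕ.+ 0)))
... | ()
1≢2* -[1+ n ] ()

odd≢even : ∀ u v → 1ℤ + + 2 * u ≢ + 2 * v
odd≢even u v e = 1≢2* (v - u) (trans (ring₁ u) (trans (cong (_- + 2 * u) e) (ring₂ u v)))
  where
  ring₁ : ∀ u → 1ℤ ≡ (1ℤ + + 2 * u) - + 2 * u
  ring₁ = solve-∀
  ring₂ : ∀ u v → + 2 * v - + 2 * u ≡ + 2 * (v - u)
  ring₂ = solve-∀

parityℕ : ∀ n → ∃[ m ] (n ≡ m ℕ.+ m ⊎ n ≡ suc (m ℕ.+ m))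
parityℕ zero = 0 , inj₁ refl
parityℕ (suc n) with parityℕ n
... | m , inj₁ p = m , inj₂ (cong suc p)
... | m , inj₂ p = suc m , inj₁ (trans (cong suc p) (sym (cong suc (ℕₚ.+-suc m m))))

parity : ∀ z → ∃[ m ] (z ≡ + 2 * m ⊎ z ≡ 1ℤ + + 2 * m)
parity (+ n) with parityℕ n
... | m , inj₁ refl = + m , inj₁ (double (+ m))
  where
  double : ∀ m → m + m ≡ + 2 * m
  double = solve-∀
... | m , inj₂ refl = + m , inj₂ (double (+ m))
  where
  double : ∀ m → 1ℤ + (m + m) ≡ 1ℤ + + 2 * m
  double = solve-∀
parity -[1+ n ] with parityℕ n
... | m , inj₁ refl = - (+ m) - 1ℤ , inj₂ (double (+ m))
  where
  double : ∀ m → - (1ℤ + (m + m)) ≡ 1ℤ + + 2 * (- m - 1ℤ)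
  double = solve-∀
... | m , inj₂ refl = - (+ m) - 1ℤ , inj₁ (double (+ m))
  where
  double : ∀ m → - (1ℤ + (1ℤ + (m + m))) ≡ + 2 * (- m - 1ℤ)
  double = solve-∀

2^suc : ∀ a → 2 ^ suc a ≡ 2 ^ a ℕ.+ 2 ^ a
2^suc a = cong (2 ^ a ℕ.+_) (ℕₚ.+-identityʳ (2 ^ a))

halve-< : ∀ m {n} → m ℕ.+ m < n ℕ.+ n → m < n
halve-< m {n} p = ℕₚ.≰⇒> λ n≤m → ℕₚ.<⇒≱ p (ℕₚ.+-mono-≤ n≤m n≤m)

-- 0 < j < 2^r gives 2^r + j the same 2-adic valuation as j.
odd-multiple≢ : ∀ r j b p q → 0 < j → j < 2 ^ r →
  (1ℤ + + 2 * b) * (+ (2 ^ r) + + j) ≢ + 2 * (+ (2 ^ r) * p + + j * q)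
odd-multiple≢ zero (suc j) b p q 0<j (s≤s ()) e
odd-multiple≢ (suc r) j b p q 0<j j<2^r e with parityℕ j | subst (j <_) (2^suc r) j<2^r
... | zero , inj₁ refl | _ = ℕₚ.<-irrefl refl 0<j
-- For even j, both 2^r and j are halved and a common factor 2 cancels.
... | m@(suc _) , inj₁ refl | j<h+h = odd-multiple≢ r m b p q (s≤s z≤n) (halve-< m j<h+h)
  (ℤₚ.*-cancelˡ-≡ (+ 2) _ _ (trans (ring₁ b (+ (2 ^ r)) (+ m)) (trans e′ (ring₂ (+ (2 ^ r)) (+ m) p q))))
  where
  e′ : (1ℤ + + 2 * b) * ((+ (2 ^ r) + + (2 ^ r)) + (+ m + + m)) ≡
       + 2 * ((+ (2 ^ r) + + (2 ^ r)) * p + (+ m + + m) * q)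
  e′ = subst (λ N → (1ℤ + + 2 * b) * (+ N + + (m ℕ.+ m)) ≡ + 2 * (+ N * p + + (m ℕ.+ m) * q)) (2^suc r) e
  ring₁ : ∀ b h m → + 2 * ((1ℤ + + 2 * b) * (h + m)) ≡ (1ℤ + + 2 * b) * ((h + h) + (m + m))
  ring₁ = solve-∀
  ring₂ : ∀ h m p q → + 2 * ((h + h) * p + (m + m) * q) ≡ + 2 * (+ 2 * (h * p + m * q))
  ring₂ = solve-∀
-- For odd j the left side is a product of two odd numbers.
... | m , inj₂ refl | _ = odd≢even (b + (1ℤ + + 2 * b) * (+ (2 ^ r) + + m)) _ (trans (ring (+ (2 ^ r)) b (+ m)) e′)
  where
  e′ : (1ℤ + + 2 * b) * ((+ (2 ^ r) + + (2 ^ r)) + (1ℤ + (+ m + + m))) ≡ + 2 * (+ (2 ^ suc r) * p + + (suc (m ℕ.+ m)) * q)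
  e′ = subst (λ N → (1ℤ + + 2 * b) * (+ N + (1ℤ + (+ m + + m))) ≡ + 2 * (+ (2 ^ suc r) * p + + (suc (m ℕ.+ m)) * q)) (2^suc r) e
  ring : ∀ h b m → 1ℤ + + 2 * (b + (1ℤ + + 2 * b) * (h + m)) ≡ (1ℤ + + 2 * b) * ((h + h) + (1ℤ + (m + m)))
  ring = solve-∀

-- The subgroup of ℤ/2ʳ⁺¹ generated by a nonzero element contains 2ʳ.
multiple≡half : ∀ r i → 0 < i → i < 2 ^ r ℕ.+ 2 ^ r →
  ∃[ k ] ∃[ l ] (k ℕ.* i ≡ 2 ^ r ℕ.+ l ℕ.* (2 ^ r ℕ.+ 2 ^ r))
multiple≡half zero (suc zero) 0<i i<n = 1 , 0 , refl
multiple≡half zero (suc (suc i)) 0<i (s≤s (s≤s ()))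
multiple≡half (suc r) i 0<i i<n with parityℕ i
... | zero , inj₁ refl = ⊥-elim (ℕₚ.<-irrefl refl 0<i)
... | m@(suc _) , inj₁ refl with multiple≡half r m (s≤s z≤n) (halve-< m (subst (λ N → m ℕ.+ m < N ℕ.+ N) (2^suc r) i<n))
...   | k , l , e = k , l , (begin
  k ℕ.* (m ℕ.+ m)                          ≡⟨ ℕₚ.*-distribˡ-+ k m m ⟩
  k ℕ.* m ℕ.+ k ℕ.* m                      ≡⟨ cong₂ ℕ._+_ e e ⟩
  (2 ^ r ℕ.+ l ℕ.* (2 ^ r ℕ.+ 2 ^ r)) ℕ.+ (2 ^ r ℕ.+ l ℕ.* (2 ^ r ℕ.+ 2 ^ r)) ≡⟨ ring (2 ^ r) l ⟩
  2 ^ suc r ℕ.+ l ℕ.* (2 ^ suc r ℕ.+ 2 ^ suc r) ∎)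
  where
  open ≡-Reasoning
  ring : ∀ h l → (h ℕ.+ l ℕ.* (h ℕ.+ h)) ℕ.+ (h ℕ.+ l ℕ.* (h ℕ.+ h)) ≡ 2 ℕ.* h ℕ.+ l ℕ.* (2 ℕ.* h ℕ.+ 2 ℕ.* h)
  ring = ℕ-Solver.solve-∀
-- With h = 2^(r+1) and i = 2m + 1 odd, h · i = h + m · 2h.
multiple≡half (suc r) i 0<i i<n | m , inj₂ refl = 2 ^ suc r , m , ring (2 ^ suc r) m
  where
  ring : ∀ h m → h ℕ.* suc (m ℕ.+ m) ≡ h ℕ.+ m ℕ.* (h ℕ.+ h)
  ring = ℕ-Solver.solve-∀

-- The convolution equation

module Indicator (x : ℤ → ℤ) (x∈01 : ∀ z → x z ≡ 0ℤ ⊎ x z ≡ 1ℤ) where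

  E : ℤ → ℤ
  E z = x z + x (- z)

  -- The coefficients of X(X + X⁻), summed over one period n of the indicator x of X.
  conv : ℕ → ℤ → ℤ
  conv n z = ∑< n (λ i → x i * E (z - i))

  E-even : ∀ z → E (- z) ≡ E z
  E-even z = trans (cong (λ w → x (- z) + x w) (ℤₚ.neg-involutive z)) (ℤₚ.+-comm (x (- z)) (x z))

  E∈012 : ∀ z → E z ≡ 0ℤ ⊎ E z ≡ 1ℤ ⊎ E z ≡ + 2
  E∈012 z with x∈01 z | x∈01 (- z)
  ... | inj₁ p | inj₁ q = inj₁ (cong₂ _+_ p q)
  ... | inj₁ p | inj₂ q = inj₂ (inj₁ (cong₂ _+_ p q))
  ... | inj₂ p | inj₁ q = inj₂ (inj₁ (cong₂ _+_ p q))
  ... | inj₂ p | inj₂ q = inj₂ (inj₂ (cong₂ _+_ p q))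

  x-nonneg : ∀ z → 0ℤ ℤ.≤ x z
  x-nonneg z with x∈01 z
  ... | inj₁ p rewrite p = ℤ.+≤+ z≤n
  ... | inj₂ p rewrite p = ℤ.+≤+ z≤n

  E-nonneg : ∀ z → 0ℤ ℤ.≤ E z
  E-nonneg z = ℤₚ.+-mono-≤ (x-nonneg z) (x-nonneg (- z))

  E≡0⇒x≡0 : ∀ z → E z ≡ 0ℤ → x z ≡ 0ℤ
  E≡0⇒x≡0 z e = ℤₚ.≤-antisym
    (nonneg+nonneg≤0 (x-nonneg z) (x-nonneg (- z)) (ℤₚ.≤-reflexive e)) (x-nonneg z)

  module _ {n : ℕ} (per : Periodic n x) where

    periodic-neg : Periodic n (λ z → x (- z))
    periodic-neg z = trans (sym (per (- (z + + n)))) (cong x (ring z (+ n)))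
      where
      ring : ∀ z n → - (z + n) + n ≡ - z
      ring = solve-∀

    E-periodic : Periodic n E
    E-periodic z = cong₂ _+_ (per z) (periodic-neg z)

    E-reflect-periodic : ∀ w → Periodic n (λ z → E (w - z))
    E-reflect-periodic w z = trans (trans (sym (E-even (w - (z + + n)))) (trans (cong E (ring w z (+ n))) (E-periodic (z - w))))
      (trans (sym (E-even (z - w))) (cong E (ring′ w z)))
      where
      ring : ∀ w z n → - (w - (z + n)) ≡ (z - w) + n
      ring = solve-∀
      ring′ : ∀ w z → - (z - w) ≡ w - z
      ring′ = solve-∀

    conv-reflect : ∀ z → conv n z ≡ ∑< n (λ i → x (z - i) * E i)
    conv-reflect z = trans
      (sym (∑-reflect n (λ i → x i * E (z - i)) z (λ i → cong₂ _*_ (per i) (E-reflect-periodic z i))))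
      (∑-cong n (λ i → cong (λ w → x (z - i) * E w) (ring z i)))
      where
      ring : ∀ z i → z - (z - i) ≡ i
      ring = solve-∀

    ∑E : ∑< n E ≡ ∑< n x + ∑< n x
    ∑E = trans (∑-+ n x (λ z → x (- z))) (+-congˡ (∑< n x) (∑-neg n x per))

  -- Condition (i) for γ = r + 1, where h = 2ʳ.
  record Shape (h : ℕ) : Set where
    field
      E-zero : E 0ℤ ≡ 0ℤ
      E-half : E (+ h) ≡ + 2
      E-low  : ∀ i → 0 < i → i < h → E (+ i) ≡ 1ℤ
      E-high : ∀ i → 0 < i → i < h → E (+ h + + i) ≡ 1ℤ

  -- Under `Shape`, E - 1 is -1 at 0, 1 at h and 0 elsewhere. Convolving x with E thus gives |X|
  -- minus x plus the translate of x by h.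
  conv-Shape : ∀ h → 0 < h → Periodic (h ℕ.+ h) x → Shape h →
    ∀ z → conv (h ℕ.+ h) z ≡ ∑< (h ℕ.+ h) x + (x (z - + h) - x z)
  conv-Shape h 0<h per shape z = begin
    conv n z ≡⟨ conv-reflect per z ⟩
    ∑< n (λ i → x (z - i) * E i) ≡⟨ ∑-cong n (λ i → ring₁ (x (z - i)) (E i)) ⟩
    ∑< n (λ i → x (z - i) + x (z - i) * (E i - 1ℤ)) ≡⟨ ∑-+ n (λ i → x (z - i)) _ ⟩
    ∑< n (λ i → x (z - i)) + ∑< n (λ i → x (z - i) * (E i - 1ℤ))
      ≡⟨ cong₂ _+_ (∑-reflect n x z per)
           (∑-two-heads h _ 0<h (λ i p q → vanish (x (z - + i)) (E-low i p q))
             (λ i p q → vanish (x (z - (+ h + + i))) (E-high i p q))) ⟩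
    ∑< n x + (x (z - 0ℤ) * (E 0ℤ - 1ℤ) + x (z - + h) * (E (+ h) - 1ℤ))
      ≡⟨ +-congˡ (∑< n x) (cong₂ (λ a b → x (z - 0ℤ) * (a - 1ℤ) + x (z - + h) * (b - 1ℤ)) E-zero E-half) ⟩
    ∑< n x + (x (z - 0ℤ) * (0ℤ - 1ℤ) + x (z - + h) * (+ 2 - 1ℤ))
      ≡⟨ +-congˡ (∑< n x) (cong (λ w → x w * (0ℤ - 1ℤ) + x (z - + h) * (+ 2 - 1ℤ)) (ℤₚ.+-identityʳ z)) ⟩
    ∑< n x + (x z * (0ℤ - 1ℤ) + x (z - + h) * (+ 2 - 1ℤ))
      ≡⟨ +-congˡ (∑< n x) (ring₂ (x z) (x (z - + h))) ⟩
    ∑< n x + (x (z - + h) - x z) ∎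
    where
    open ≡-Reasoning
    open Shape shape
    n : ℕ
    n = h ℕ.+ h
    ring₁ : ∀ a e → a * e ≡ a + a * (e - 1ℤ)
    ring₁ = solve-∀
    ring₂ : ∀ a b → a * (0ℤ - 1ℤ) + b * (+ 2 - 1ℤ) ≡ b - a
    ring₂ = solve-∀
    vanish : ∀ a {e} → e ≡ 1ℤ → a * (e - 1ℤ) ≡ 0ℤ
    vanish a refl = ℤₚ.*-zeroʳ a

  -- Periods of E from sums of squares

  module Equation (n k : ℕ) (c μ : ℤ) (0<n : 0 < n) (per : Periodic n x) (x0 : x 0ℤ ≡ 0ℤ)
                  (eqn : ∀ z → +[1+ k ] * conv n z ≡ c * x z + μ) where

    E0 : E 0ℤ ≡ 0ℤ
    E0 = cong₂ _+_ x0 x0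

    EE : ℤ → ℤ
    EE z = ∑< n (λ i → E i * E (z - i))

    -- Since E is even, X⁻E is the reflection of XE; the equations at z and -z are added.
    EE-eqn : ∀ z → +[1+ k ] * EE z ≡ c * E z + (μ + μ)
    EE-eqn z = begin
      +[1+ k ] * EE z
        ≡⟨ cong (+[1+ k ] *_) (trans (∑-cong n (λ i → ℤₚ.*-distribʳ-+ (E (z - i)) (x i) (x (- i)))) (∑-+ n (λ i → x i * E (z - i)) _)) ⟩
      +[1+ k ] * (conv n z + ∑< n (λ i → x (- i) * E (z - i)))
        ≡⟨ cong (λ s → +[1+ k ] * (conv n z + s)) second ⟩
      +[1+ k ] * (conv n z + conv n (- z))
        ≡⟨ ℤₚ.*-distribˡ-+ +[1+ k ] (conv n z) (conv n (- z)) ⟩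
      +[1+ k ] * conv n z + +[1+ k ] * conv n (- z)
        ≡⟨ cong₂ _+_ (eqn z) (eqn (- z)) ⟩
      (c * x z + μ) + (c * x (- z) + μ)
        ≡⟨ ring c (x z) (x (- z)) μ ⟩
      c * E z + (μ + μ) ∎
      where
      open ≡-Reasoning
      ring : ∀ c a b m → (c * a + m) + (c * b + m) ≡ c * (a + b) + (m + m)
      ring = solve-∀
      ring₂ : ∀ z i → - (z - - i) ≡ - z - i
      ring₂ = solve-∀
      second : ∑< n (λ i → x (- i) * E (z - i)) ≡ conv n (- z)
      second = trans
        (sym (∑-neg n (λ i → x (- i) * E (z - i)) (λ i → cong₂ _*_ (periodic-neg per i) (E-reflect-periodic per z i))))
        (∑-cong n (λ i → cong₂ _*_ (cong x (ℤₚ.neg-involutive i))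
          (trans (sym (E-even (z - - i))) (cong E (ring₂ z i)))))

    sqdiff : ℤ → ℤ → ℤ
    sqdiff w i = (E i - E (w + i)) * (E i - E (w + i))

    sqdiff-periodic : ∀ w → Periodic n (sqdiff w)
    sqdiff-periodic w i = cong₂ (λ a b → (a - b) * (a - b)) (E-periodic per i)
      (periodic-shift n E w (E-periodic per) i)

    -- Expanding the square gives 2 `EE` 0 - 2 `EE` (-w), because E is even and the sum of squares
    -- is translation invariant. By `EE-eqn` the μ terms cancel, and E 0 = 0 removes the rest of
    -- `EE` 0.
    ∑-sqdiff : ∀ w → +[1+ k ] * ∑< n (sqdiff w) ≡ - (c * E w + c * E w)
    ∑-sqdiff w = begin
      +[1+ k ] * ∑< n (sqdiff w)
        ≡⟨ cong (+[1+ k ] *_) (trans (∑-cong n expand) (trans (∑-+ n (λ i → sq i + sq (w + i)) _)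
             (cong₂ _+_ (∑-+ n sq (λ i → sq (w + i))) (∑-*ˡ n (- + 2) (λ i → E i * E (- w - i)))))) ⟩
      +[1+ k ] * ((∑< n sq + ∑< n (λ i → sq (w + i))) + - + 2 * EE (- w))
        ≡⟨ cong (λ s → +[1+ k ] * ((∑< n sq + s) + - + 2 * EE (- w))) (∑-shift n sq w sq-periodic) ⟩
      +[1+ k ] * ((∑< n sq + ∑< n sq) + - + 2 * EE (- w))
        ≡⟨ cong (λ s → +[1+ k ] * ((s + s) + - + 2 * EE (- w))) ∑sq≡EE0 ⟩
      +[1+ k ] * ((EE 0ℤ + EE 0ℤ) + - + 2 * EE (- w))
        ≡⟨ ring +[1+ k ] (EE 0ℤ) (EE (- w)) ⟩
      + 2 * (+[1+ k ] * EE 0ℤ) - + 2 * (+[1+ k ] * EE (- w))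
        ≡⟨ cong₂ (λ a b → + 2 * a - + 2 * b) (trans (EE-eqn 0ℤ) (cong (λ e → c * e + (μ + μ)) E0))
             (trans (EE-eqn (- w)) (cong (λ e → c * e + (μ + μ)) (E-even w))) ⟩
      + 2 * (c * 0ℤ + (μ + μ)) - + 2 * (c * E w + (μ + μ))
        ≡⟨ ring₂ c (E w) μ ⟩
      - (c * E w + c * E w) ∎
      where
      open ≡-Reasoning
      sq : ℤ → ℤ
      sq i = E i * E i
      sq-periodic : Periodic n sq
      sq-periodic i = cong (λ e → e * e) (E-periodic per i)
      ring : ∀ k a b → k * ((a + a) + - + 2 * b) ≡ + 2 * (k * a) - + 2 * (k * b)
      ring = solve-∀
      ring₂ : ∀ c e m → + 2 * (c * 0ℤ + (m + m)) - + 2 * (c * e + (m + m)) ≡ - (c * e + c * e)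
      ring₂ = solve-∀
      ring₃ : ∀ a b → (a - b) * (a - b) ≡ (a * a + b * b) + - + 2 * (a * b)
      ring₃ = solve-∀
      ring₄ : ∀ w i → - (w + i) ≡ - w - i
      ring₄ = solve-∀
      expand : ∀ i → sqdiff w i ≡ (sq i + sq (w + i)) + - + 2 * (E i * E (- w - i))
      expand i = trans (ring₃ (E i) (E (w + i)))
        (cong (λ e → (sq i + sq (w + i)) + - + 2 * (E i * e)) (trans (sym (E-even (w + i))) (cong E (ring₄ w i))))
      ∑sq≡EE0 : ∑< n sq ≡ EE 0ℤ
      ∑sq≡EE0 = ∑-cong n (λ i → cong (E i *_) (trans (sym (E-even i)) (cong E (sym (ℤₚ.+-identityˡ (- i))))))

    -- By `∑-sqdiff` a sum of squares is then at most 0, so every difference vanishes.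
    period-of-E : ∀ w → 0ℤ ℤ.≤ c * E w → ∀ i → E (w + i) ≡ E i
    period-of-E w 0≤cE i = sym (ℤₚ.i-j≡0⇒i≡j (E i) (E (w + i)) (square≡0⇒≡0 _
      (∑-nonneg-periodic≤0⇒≡0 n (sqdiff w) 0<n (sqdiff-periodic w) (λ j → square-nonneg (E j - E (w + j)))
        (ℤₚ.*-cancelˡ-≤-pos _ _ +[1+ k ]
          (subst₂ ℤ._≤_ (sym (∑-sqdiff w)) (sym (ℤₚ.*-zeroʳ +[1+ k ])) (ℤₚ.neg-mono-≤ (ℤₚ.+-mono-≤ 0≤cE 0≤cE)))) i)))

    E≡0⇒period : ∀ w → E w ≡ 0ℤ → ∀ i → E (w + i) ≡ E i
    E≡0⇒period w e = period-of-E w (ℤₚ.≤-reflexive (sym (trans (cong (c *_) e) (ℤₚ.*-zeroʳ c))))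

    -- If c were nonnegative, every w would be a period of E, so E would be constantly E 0 = 0 and X
    -- empty.
    c<0 : ∑< n x ≢ 0ℤ → c ℤ.< 0ℤ
    c<0 M≢0 = ℤₚ.≰⇒> λ 0≤c → M≢0 (trans (∑-cong n {g = λ _ → 0ℤ} (λ w → E≡0⇒x≡0 w
        (trans (cong E (sym (ℤₚ.+-identityʳ w)))
          (trans (period-of-E w (nonneg-* 0≤c (E-nonneg w)) 0ℤ) E0))))
      (trans (∑-const n 0ℤ) (ℤₚ.*-zeroʳ (+ n))))

  -- The case h ∈ X

  module HalfIn (r : ℕ) (C s : ℤ) (per : Periodic (2 ^ r ℕ.+ 2 ^ r) x) (x0 : x 0ℤ ≡ 0ℤ)
                (x-half : x (+ (2 ^ r)) ≡ 1ℤ)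
                (eqn : ∀ z → conv (2 ^ r ℕ.+ 2 ^ r) z ≡ s - C * x z)
                (s<2M : s ℤ.< ∑< (2 ^ r ℕ.+ 2 ^ r) x + ∑< (2 ^ r ℕ.+ 2 ^ r) x) where

    h n : ℕ
    h = 2 ^ r
    n = h ℕ.+ h

    M : ℤ
    M = ∑< n x

    0<h : 0 < h
    0<h = ℕₚ.m^n>0 2 r

    0<n : 0 < n
    0<n = ℕₚ.≤-trans 0<h (ℕₚ.m≤m+n h h)

    eqn′ : ∀ z → 1ℤ * conv n z ≡ - C * x z + s
    eqn′ z = trans (ℤₚ.*-identityˡ (conv n z)) (trans (eqn z) (ring s C (x z)))
      where
      ring : ∀ s c a → s - c * a ≡ - c * a + s
      ring = solve-∀

    open Equation n 0 (- C) s 0<n per x0 eqn′ using (E0; EE; EE-eqn; sqdiff; ∑-sqdiff; E≡0⇒period)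

    E-half : E (+ h) ≡ + 2
    E-half = cong₂ _+_ x-half (trans (sym (per (- + h))) (trans (cong x (ring (+ h))) x-half))
      where
      ring : ∀ h → - h + (h + h) ≡ h
      ring = solve-∀

    E≢0 : ∀ i → 0 < i → i < n → E (+ i) ≢ 0ℤ
    E≢0 i 0<i i<n Ei≡0 with multiple≡half r i 0<i i<n
    ... | k , l , e = 2≢0 (trans (sym (at-half l)) (trans (cong (λ j → E (+ j)) (sym e)) (at-multiple k)))
      where
      2≢0 : + 2 ≢ 0ℤ
      2≢0 ()
      at-multiple : ∀ k → E (+ (k ℕ.* i)) ≡ 0ℤ
      at-multiple zero    = E0
      at-multiple (suc k) = trans (E≡0⇒period (+ i) Ei≡0 (+ (k ℕ.* i))) (at-multiple k)
      at-half : ∀ l → E (+ (h ℕ.+ l ℕ.* n)) ≡ + 2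
      at-half zero    = trans (cong (λ j → E (+ j)) (ℕₚ.+-identityʳ h)) E-half
      at-half (suc l) = trans (cong (λ j → E (+ j)) (ring h l))
        (trans (E-periodic per (+ (h ℕ.+ l ℕ.* n))) (at-half l))
        where
        ring : ∀ h l → h ℕ.+ (h ℕ.+ h ℕ.+ l ℕ.* (h ℕ.+ h)) ≡ h ℕ.+ l ℕ.* (h ℕ.+ h) ℕ.+ (h ℕ.+ h)
        ring = ℕ-Solver.solve-∀

    E∈12 : ∀ i → 0 < i → i < n → E (+ i) ≡ 1ℤ ⊎ E (+ i) ≡ + 2
    E∈12 i 0<i i<n with E∈012 (+ i)
    ... | inj₁ e        = ⊥-elim (E≢0 i 0<i i<n e)
    ... | inj₂ e        = e

    low<n : ∀ {i} → i < h → i < n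
    low<n i<h = ℕₚ.≤-trans i<h (ℕₚ.m≤m+n h h)

    high<n : ∀ {i} → i < h → h ℕ.+ i < n
    high<n = ℕₚ.+-monoʳ-< h

    0<high : ∀ i → 0 < h ℕ.+ i
    0<high i = ℕₚ.≤-trans 0<h (ℕₚ.m≤m+n h i)

    -- The indicator of X ∩ X⁻.
    xx : ℤ → ℤ
    xx i = x i * x (- i)

    -- Inclusion-exclusion: by `E≢0` the union X ∪ X⁻ is everything except 0, so it has n - 1
    -- elements.
    ∑xx : ∑< n xx ≡ M + M - + n + 1ℤ
    ∑xx = begin
      ∑< n xx ≡⟨ ring₁ (∑< n xx) (+ n) (M + M) ⟩
      (+ n * 1ℤ + (- 1ℤ) * (M + M) + ∑< n xx) + (M + M) - + n ≡⟨ cong (λ t → t + (M + M) - + n) (trans (sym total) head) ⟩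
      1ℤ + (M + M) - + n ≡⟨ ring₂ (M + M) (+ n) ⟩
      M + M - + n + 1ℤ ∎
      where
      open ≡-Reasoning
      -- `q i` equals (1 - x(i))(1 - x(-i)), the indicator of the complement of X ∪ X⁻, which is
      -- {0}.
      q : ℤ → ℤ
      q i = 1ℤ + (- 1ℤ) * E i + xx i
      ring₁ : ∀ p n m → p ≡ (n * 1ℤ + (- 1ℤ) * m + p) + m - n
      ring₁ = solve-∀
      ring₂ : ∀ m n → 1ℤ + m - n ≡ m - n + 1ℤ
      ring₂ = solve-∀
      total : ∑< n q ≡ + n * 1ℤ + (- 1ℤ) * (M + M) + ∑< n xx
      total = trans (∑-+ n (λ i → 1ℤ + (- 1ℤ) * E i) xx) (cong (_+ ∑< n xx)
        (trans (∑-+ n (λ _ → 1ℤ) (λ i → (- 1ℤ) * E i)) (cong₂ _+_ (∑-const n 1ℤ)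
          (trans (∑-*ˡ n (- 1ℤ) E) (cong ((- 1ℤ) *_) (∑E per))))))
      q≡0 : ∀ i → 0 < i → i < n → q (+ i) ≡ 0ℤ
      q≡0 i 0<i i<n with E≢0 i 0<i i<n | x∈01 (+ i) | x∈01 (- + i)
      ... | E≢0 | inj₁ a | inj₁ b = ⊥-elim (E≢0 (cong₂ _+_ a b))
      ... | _   | inj₁ a | inj₂ b rewrite a | b = refl
      ... | _   | inj₂ a | inj₁ b rewrite a | b = refl
      ... | _   | inj₂ a | inj₂ b rewrite a | b = refl
      head : ∑< n q ≡ 1ℤ
      head = trans (∑-head n q 0<n q≡0) (cong₂ (λ a b → 1ℤ + (- 1ℤ) * (a + b) + a * b) x0 x0)

    -- At z = 0 the convolution is the sum of x(i)(x(i) + x(-i)), that is |X| + |X ∩ X⁻|.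
    s≡ : s ≡ M + (M + M - + n + 1ℤ)
    s≡ = begin
      s                ≡⟨ ring s C ⟩
      s - C * 0ℤ       ≡⟨ cong (λ a → s - C * a) (sym x0) ⟩
      s - C * x 0ℤ     ≡⟨ sym (eqn 0ℤ) ⟩
      conv n 0ℤ        ≡⟨ ∑-cong n term ⟩
      ∑< n (λ i → x i + xx i) ≡⟨ ∑-+ n x xx ⟩
      M + ∑< n xx      ≡⟨ +-congˡ M ∑xx ⟩
      M + (M + M - + n + 1ℤ) ∎
      where
      open ≡-Reasoning
      ring : ∀ s c → s ≡ s - c * 0ℤ
      ring = solve-∀
      idem : ∀ i → x i * x i ≡ x i
      idem i with x∈01 i
      ... | inj₁ a rewrite a = refl
      ... | inj₂ a rewrite a = refl
      term : ∀ i → x i * E (0ℤ - i) ≡ x i + xx i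
      term i = trans (cong (x i *_) (trans (cong E (ℤₚ.+-identityˡ (- i))) (E-even i)))
        (trans (ℤₚ.*-distribˡ-+ (x i) (x i) (x (- i))) (cong (_+ xx i) (idem i)))

    -- The equation is summed over all z; the coefficients of XE sum to |X| · 2|X|.
    ∑-conv : (M + M) * M ≡ + n * s - C * M
    ∑-conv = begin
      (M + M) * M ≡⟨ sym (∑-*ˡ n (M + M) x) ⟩
      ∑< n (λ i → (M + M) * x i) ≡⟨ ∑-cong n inner ⟩
      ∑< n (λ i → ∑< n (λ z → x i * E (z - i))) ≡⟨ ∑-swap n n (λ i z → x i * E (z - i)) ⟩
      ∑< n (conv n) ≡⟨ ∑-cong n (λ z → trans (eqn z) (ring s C (x z))) ⟩
      ∑< n (λ z → s + (- C) * x z) ≡⟨ ∑-+ n (λ _ → s) (λ z → (- C) * x z) ⟩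
      ∑< n (λ _ → s) + ∑< n (λ z → (- C) * x z) ≡⟨ cong₂ _+_ (∑-const n s) (∑-*ˡ n (- C) x) ⟩
      + n * s + (- C) * M ≡⟨ sym (ring (+ n * s) C M) ⟩
      + n * s - C * M ∎
      where
      open ≡-Reasoning
      ring : ∀ s c a → s - c * a ≡ s + (- c) * a
      ring = solve-∀
      inner : ∀ i → (M + M) * x i ≡ ∑< n (λ z → x i * E (z - i))
      inner i = trans (ℤₚ.*-comm (M + M) (x i)) (trans (cong (x i *_) (sym (trans
          (trans (∑-cong n (λ z → cong E (ℤₚ.+-comm z (- i)))) (∑-shift n E (- i) (E-periodic per))) (∑E per))))
        (sym (∑-*ˡ n (x i) (λ z → E (z - i)))))

    -- Writing |X| = h + j with j an integer, `∑xx` becomes 2j + 1, and a cardinality is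
    -- nonnegative.
    excess : ∃[ j ] M ≡ + h + + j
    excess = split (M - + h) refl
      where
      ring₁ : ∀ m h → m ≡ h + (m - h)
      ring₁ = solve-∀
      ring₂ : ∀ h j → (h + j) + (h + j) - (h + h) + 1ℤ ≡ j + j + 1ℤ
      ring₂ = solve-∀
      xx-nonneg : 0ℤ ℤ.≤ ∑< n xx
      xx-nonneg = ∑-nonneg n xx (λ i _ → nonneg-* (x-nonneg (+ i)) (x-nonneg (- + i)))
      split : ∀ j → M - + h ≡ j → ∃[ j ] M ≡ + h + + j
      split (+ j)    e = j , trans (ring₁ M (+ h)) (+-congˡ (+ h) e)
      split -[1+ j ] e = ⊥-elim (¬0≤ (subst (0ℤ ℤ.≤_) (trans ∑xx (trans
          (cong (λ m → m + m - + n + 1ℤ) (trans (ring₁ M (+ h)) (+-congˡ (+ h) e))) (ring₂ (+ h) -[1+ j ]))) xx-nonneg))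
        where
        ¬0≤ : 0ℤ ℤ.≤ -[1+ j ] + -[1+ j ] + 1ℤ → ⊥
        ¬0≤ ()

    module _ (j : ℕ) (M≡ : M ≡ + h + + j) where

      -- By `s≡`, s = (h + j) + (2j + 1), which is below 2(h + j) by `s<2M`; subtracting h + 2j
      -- leaves the claim.
      suc-j<h : suc j < h
      suc-j<h = ℤₚ.drop‿+<+ (subst₂ ℤ._<_ (left (+ h) (+ j)) (right (+ h) (+ j))
        (ℤₚ.+-monoʳ-< (- + h - + j - + j) s<2M′))
        where
        s<2M′ : (+ h + + j) + ((+ h + + j) + (+ h + + j) - (+ h + + h) + 1ℤ) ℤ.< (+ h + + j) + (+ h + + j)
        s<2M′ = subst₂ ℤ._<_ (trans s≡ (cong (λ m → m + (m + m - + n + 1ℤ)) M≡)) (cong (λ m → m + m) M≡) s<2M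
        left : ∀ h j → (- h - j - j) + ((h + j) + ((h + j) + (h + j) - (h + h) + 1ℤ)) ≡ 1ℤ + j
        left = solve-∀
        right : ∀ h j → (- h - j - j) + ((h + j) + (h + j)) ≡ h
        right = solve-∀

      -- Substituting `s≡` in `∑-conv` eliminates s. The factor 1 is kept so that the right side
      -- matches `odd-multiple≢` with p = 1 and q = h - j.
      C-eqn : C * (+ h + + j) ≡ + 2 * (+ h * 1ℤ + + j * (+ h - + j))
      C-eqn = begin
        C * (+ h + + j) ≡⟨ cong (C *_) (sym M≡) ⟩
        C * M ≡⟨ ring₁ (+ n * s) (C * M) ⟩
        + n * s - (+ n * s - C * M) ≡⟨ cong (λ t → + n * s - t) (sym ∑-conv) ⟩
        + n * s - (M + M) * M ≡⟨ cong (λ t → + n * t - (M + M) * M) s≡ ⟩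
        + n * (M + (M + M - + n + 1ℤ)) - (M + M) * M ≡⟨ cong (λ m → + n * (m + (m + m - + n + 1ℤ)) - (m + m) * m) M≡ ⟩
        _ ≡⟨ ring₂ (+ h) (+ j) ⟩
        + 2 * (+ h * 1ℤ + + j * (+ h - + j)) ∎
        where
        open ≡-Reasoning
        ring₁ : ∀ a b → b ≡ a - (a - b)
        ring₁ = solve-∀
        ring₂ : ∀ h j → (h + h) * ((h + j) + ((h + j) + (h + j) - (h + h) + 1ℤ)) - ((h + j) + (h + j)) * (h + j)
                ≡ + 2 * (h * 1ℤ + j * (h - j))
        ring₂ = solve-∀

    -- If j = 0, `C-eqn` gives C = 2. If 0 < j < h, an odd C would give the left side of `C-eqn` the
    -- 2-adic valuation of j, while the right side has a larger one.
    C-not-odd : ∀ b → C ≢ 1ℤ + + 2 * b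
    C-not-odd b refl with excess
    ... | zero , M≡ = odd≢even b 1ℤ (ℤₚ.*-cancelʳ-≡ _ _ (+ h) {{ℕₚ.m^n≢0 2 r}}
      (trans (cong ((1ℤ + + 2 * b) *_) (sym (ℤₚ.+-identityʳ (+ h)))) (trans (C-eqn 0 M≡) (ring (+ h)))))
      where
      ring : ∀ h → + 2 * (h * 1ℤ + 0ℤ * (h - 0ℤ)) ≡ + 2 * 1ℤ * h
      ring = solve-∀
    ... | j@(suc _) , M≡ = odd-multiple≢ r j b 1ℤ (+ h - + j) (s≤s z≤n)
      (ℕₚ.<-trans (ℕₚ.n<1+n j) (suc-j<h j M≡)) (C-eqn j M≡)

    -- Modulo 2 the square of a group ring element is supported on doubles.
    EE-double : ∀ y → ∃[ t ] EE (y + y) ≡ + 2 * t - E y * E y + E (+ h + y) * E (+ h + y)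
    -- Recentring the index at y turns the summand into E(y + i)E(y - i), which is even in i; the
    -- two unpaired terms are the squares at y and h + y.
    EE-double y = ∑< h g , trans (sym (trans (∑-cong n recentre) (∑-shift n f y f-periodic)))
      (trans (∑-even-periodic h g g-periodic g-even)
        (cong₂ (λ a b → + 2 * ∑< h g - a + b)
          (cong₂ (λ v w → E v * E w) (ℤₚ.+-identityʳ y) (ℤₚ.+-identityʳ y))
          (cong₂ _*_ (cong E (ℤₚ.+-comm y (+ h))) (trans (sym (E-periodic per (y - + h))) (cong E (ring₂ y (+ h)))))))
      where
      f g : ℤ → ℤ
      f i = E i * E ((y + y) - i)
      g i = E (y + i) * E (y - i)
      ring₁ : ∀ y i → y - i ≡ (y + y) - (y + i)
      ring₁ = solve-∀
      ring₂ : ∀ y h → (y - h) + (h + h) ≡ h + y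
      ring₂ = solve-∀
      recentre : ∀ i → g i ≡ f (y + i)
      recentre i = cong (λ w → E (y + i) * E w) (ring₁ y i)
      f-periodic : Periodic n f
      f-periodic i = cong₂ _*_ (E-periodic per i) (E-reflect-periodic per (y + y) i)
      g-periodic : Periodic n g
      g-periodic i = cong₂ _*_ (periodic-shift n E y (E-periodic per) i) (E-reflect-periodic per y i)
      g-even : ∀ i → g (- i) ≡ g i
      g-even i = trans (cong (λ w → E (y - i) * E (y + w)) (ℤₚ.neg-involutive i)) (ℤₚ.*-comm (E (y - i)) (E (y + i)))

    module _ (b : ℤ) (C≡2b : C ≡ + 2 * b) where

      EE-even : ∀ z → EE z ≡ + 2 * (s - b * E z)
      EE-even z = trans (sym (ℤₚ.*-identityˡ (EE z))) (trans (EE-eqn z)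
        (trans (cong (λ c → - c * E z + (s + s)) C≡2b) (ring b s (E z))))
        where
        ring : ∀ b s e → - (+ 2 * b) * e + (s + s) ≡ + 2 * (s - b * e)
        ring = solve-∀

      -- Both values lie in {1, 2}. If they differed, their squares would have different parity and
      -- `EE-double` would make `EE` odd at 2i, against `EE-even`.
      E-half-shift : ∀ i → 0 < i → i < h → E (+ i) ≡ E (+ h + + i)
      E-half-shift i 0<i i<h with E∈12 i 0<i (low<n i<h) | E∈12 (h ℕ.+ i) (0<high i) (high<n i<h) | EE-double (+ i)
      ... | inj₁ p | inj₁ q | _ = trans p (sym q)
      ... | inj₂ p | inj₂ q | _ = trans p (sym q)
      ... | inj₁ p | inj₂ q | t , e = ⊥-elim (odd≢even (t + 1ℤ) (s - b * E (+ i + + i)) (trans (ring t) (trans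
            (sym (trans e (cong₂ (λ u v → + 2 * t - u * u + v * v) p q))) (EE-even (+ i + + i)))))
        where
        ring : ∀ t → 1ℤ + + 2 * (t + 1ℤ) ≡ + 2 * t - 1ℤ * 1ℤ + + 2 * + 2
        ring = solve-∀
      ... | inj₂ p | inj₁ q | t , e = ⊥-elim (odd≢even (t - + 2) (s - b * E (+ i + + i)) (trans (ring t) (trans
            (sym (trans e (cong₂ (λ u v → + 2 * t - u * u + v * v) p q))) (EE-even (+ i + + i)))))
        where
        ring : ∀ t → 1ℤ + + 2 * (t - + 2) ≡ + 2 * t - + 2 * + 2 + 1ℤ * 1ℤ
        ring = solve-∀

      -- In the sum of squares for w = h only the terms at 0 and h survive, each equal to 4, whereas
      -- `∑-sqdiff` evaluates the sum to 4C.
      even⇒C≡2 : C ≡ + 2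
      even⇒C≡2 = ℤₚ.*-cancelˡ-≡ (+ 4) C (+ 2) (begin
        + 4 * C                          ≡⟨ ring C ⟩
        - (- C * + 2 + - C * + 2)        ≡⟨ cong (λ e → - (- C * e + - C * e)) (sym E-half) ⟩
        - (- C * E (+ h) + - C * E (+ h)) ≡⟨ sym (∑-sqdiff (+ h)) ⟩
        1ℤ * ∑< n (sqdiff (+ h))         ≡⟨ ℤₚ.*-identityˡ _ ⟩
        ∑< n (sqdiff (+ h))              ≡⟨ ∑-two-heads h (sqdiff (+ h)) 0<h low high ⟩
        sqdiff (+ h) 0ℤ + sqdiff (+ h) (+ h)
          ≡⟨ cong₂ _+_ (cong₂ sq-diff E0 (trans (cong E (ℤₚ.+-identityʳ (+ h))) E-half))
                       (cong₂ sq-diff E-half (trans (E-periodic per 0ℤ) E0)) ⟩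
        + 4 * + 2 ∎)
        where
        open ≡-Reasoning
        sq-diff : ℤ → ℤ → ℤ
        sq-diff u v = (u - v) * (u - v)
        ring : ∀ c → + 4 * c ≡ - (- c * + 2 + - c * + 2)
        ring = solve-∀
        ring′ : ∀ h i → h + (h + i) ≡ i + (h + h)
        ring′ = solve-∀
        diag : ∀ {u v} → u ≡ v → sq-diff u v ≡ 0ℤ
        diag {u} refl = cong (λ w → w * w) (ℤₚ.+-inverseʳ u)
        low : ∀ i → 0 < i → i < h → sqdiff (+ h) (+ i) ≡ 0ℤ
        low i 0<i i<h = diag (E-half-shift i 0<i i<h)
        high : ∀ i → 0 < i → i < h → sqdiff (+ h) (+ h + + i) ≡ 0ℤ
        high i 0<i i<h = diag (trans (sym (E-half-shift i 0<i i<h))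
          (sym (trans (cong E (ring′ (+ h) (+ i))) (E-periodic per (+ i)))))

    C≡2 : C ≡ + 2
    C≡2 with parity C
    ... | b , inj₁ even = even⇒C≡2 b even
    ... | b , inj₂ odd  = ⊥-elim (C-not-odd b odd)

    -- With C = 2, `C-eqn` reduces to j(h - (1 + j)) = 0, and 1 + j < h leaves j = 0.
    M≡h : M ≡ + h
    M≡h with excess
    ... | j , M≡ with ℤₚ.i*j≡0⇒i≡0∨j≡0 (+ j) product≡0
      where
      ring₁ : ∀ h j → j * (h - (1ℤ + j)) ≡ (h * 1ℤ + j * (h - j)) - (h + j)
      ring₁ = solve-∀
      product≡0 : + j * (+ h - + suc j) ≡ 0ℤ
      product≡0 = trans (ring₁ (+ h) (+ j)) (ℤₚ.i≡j⇒i-j≡0 (ℤₚ.*-cancelˡ-≡ (+ 2) _ _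
        (sym (trans (cong (_* (+ h + + j)) (sym C≡2)) (C-eqn j M≡)))))
    ...   | inj₁ j≡0 = trans M≡ (trans (+-congˡ (+ h) j≡0) (ℤₚ.+-identityʳ (+ h)))
    ...   | inj₂ h≡1+j = ⊥-elim (ℕₚ.<-irrefl (sym (ℤₚ.+-injective (ℤₚ.i-j≡0⇒i≡j (+ h) (+ suc j) h≡1+j))) (suc-j<h j M≡))

    -- From 1 + j < 2^r; this is the source of γ ≥ 2.
    1≤r : 1 ≤ r
    1≤r with excess
    ... | j , M≡ = ℕₚ.n≢0⇒n>0 λ r≡0 → ℕₚ.<⇒≱ (subst (λ r → suc j < 2 ^ r) r≡0 (suc-j<h j M≡)) (s≤s z≤n)

    shape : Shape h
    shape = record
      { E-zero = E0
      ; E-half = E-half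
      ; E-low  = λ i 0<i i<h → ℤₚ.i-j≡0⇒i≡j (E (+ i)) 1ℤ (ℤₚ.≤-antisym
          (nonneg+nonneg≤0 (low≥0 i 0<i i<h) (high≥0 i 0<i i<h) (ℤₚ.≤-reflexive (u≡0 i i<h)))
          (low≥0 i 0<i i<h))
      ; E-high = λ i 0<i i<h → ℤₚ.i-j≡0⇒i≡j (E (+ h + + i)) 1ℤ (ℤₚ.≤-antisym
          (nonneg+nonneg≤0 (high≥0 i 0<i i<h) (low≥0 i 0<i i<h)
            (ℤₚ.≤-reflexive (trans (ℤₚ.+-comm (E (+ h + + i) - 1ℤ) (E (+ i) - 1ℤ)) (u≡0 i i<h))))
          (high≥0 i 0<i i<h))
      }
      where
      -- Pairing i with h + i balances the -1 of E - 1 at 0 against its 1 at h. All pairs are then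
      -- nonnegative, and they sum to 2|X| - n = 0.
      u : ℤ → ℤ
      u i = (E i - 1ℤ) + (E (+ h + i) - 1ℤ)
      E-1≥0 : ∀ i → 0 < i → i < n → 0ℤ ℤ.≤ E (+ i) - 1ℤ
      E-1≥0 i 0<i i<n with E∈12 i 0<i i<n
      ... | inj₁ e rewrite e = ℤ.+≤+ z≤n
      ... | inj₂ e rewrite e = ℤ.+≤+ z≤n
      low≥0 : ∀ i → 0 < i → i < h → 0ℤ ℤ.≤ E (+ i) - 1ℤ
      low≥0 i 0<i i<h = E-1≥0 i 0<i (low<n i<h)
      high≥0 : ∀ i → 0 < i → i < h → 0ℤ ℤ.≤ E (+ h + + i) - 1ℤ
      high≥0 i 0<i i<h = E-1≥0 (h ℕ.+ i) (0<high i) (high<n i<h)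
      u≥0 : ∀ i → i < h → 0ℤ ℤ.≤ u (+ i)
      u≥0 zero    i<h = ℤₚ.≤-reflexive (sym (cong₂ (λ v w → (v - 1ℤ) + (w - 1ℤ)) E0
        (trans (cong E (ℤₚ.+-identityʳ (+ h))) E-half)))
      u≥0 (suc i) i<h = ℤₚ.+-mono-≤ (low≥0 (suc i) (s≤s z≤n) i<h) (high≥0 (suc i) (s≤s z≤n) i<h)
      ring : ∀ h → (h + h) + (h + h) * - 1ℤ ≡ 0ℤ
      ring = solve-∀
      ∑u : ∑< h u ≡ 0ℤ
      ∑u = begin
        ∑< h u ≡⟨ ∑-+ h (λ i → E i - 1ℤ) (λ i → E (+ h + i) - 1ℤ) ⟩
        ∑< h (λ i → E i - 1ℤ) + ∑< h (λ i → E (+ h + i) - 1ℤ) ≡⟨ sym (∑-split h h (λ i → E i - 1ℤ)) ⟩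
        ∑< n (λ i → E i - 1ℤ) ≡⟨ ∑-+ n E (λ _ → - 1ℤ) ⟩
        ∑< n E + ∑< n (λ _ → - 1ℤ) ≡⟨ cong₂ _+_ (trans (∑E per) (cong (λ m → m + m) M≡h)) (∑-const n (- 1ℤ)) ⟩
        (+ h + + h) + (+ h + + h) * - 1ℤ ≡⟨ ring (+ h) ⟩
        0ℤ ∎
        where open ≡-Reasoning
      u≡0 : ∀ i → i < h → u (+ i) ≡ 0ℤ
      u≡0 = ∑≤0⇒term≡0 h u u≥0 (ℤₚ.≤-reflexive ∑u)

    -- `conv-Shape` and the equation are two expressions for the same convolution; with |X| = h, C =
    -- 2 and s = h + 1 they differ by exactly this identity.
    complement : ∀ z → x z + x (z - + h) ≡ 1ℤ
    complement z = begin
      x z + x (z - + h) ≡⟨ ring₁ M (x z) (x (z - + h)) ⟩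
      (M + (x (z - + h) - x z)) + (+ 2 * x z - M)
        ≡⟨ cong (_+ (+ 2 * x z - M)) (sym (conv-Shape h 0<h per shape z)) ⟩
      conv n z + (+ 2 * x z - M) ≡⟨ cong (_+ (+ 2 * x z - M)) (eqn z) ⟩
      (s - C * x z) + (+ 2 * x z - M)
        ≡⟨ cong₂ (λ t c → (t - c * x z) + (+ 2 * x z - M)) s≡ C≡2 ⟩
      ((M + (M + M - + n + 1ℤ)) - + 2 * x z) + (+ 2 * x z - M)
        ≡⟨ cong (λ m → ((m + (m + m - + n + 1ℤ)) - + 2 * x z) + (+ 2 * x z - m)) M≡h ⟩
      _ ≡⟨ ring₂ (+ h) (x z) ⟩
      1ℤ ∎
      where
      open ≡-Reasoning
      ring₁ : ∀ m a b → a + b ≡ (m + (b - a)) + (+ 2 * a - m)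
      ring₁ = solve-∀
      ring₂ : ∀ h a → ((h + (h + h - (h + h) + 1ℤ)) - + 2 * a) + (+ 2 * a - h) ≡ 1ℤ
      ring₂ = solve-∀

  -- Descent to smaller periods

  record Classified (α : ℕ) : Set where
    field
      r          : ℕ
      1≤r        : 1 ≤ r
      r<α        : r < α
      periodic   : Periodic (2 ^ r ℕ.+ 2 ^ r) x
      shape      : Shape (2 ^ r)
      complement : ∀ z → x z + x (z - + (2 ^ r)) ≡ 1ℤ

  -- The factor k + 1 counts how often the current period fits into the original one.
  classify : ∀ α k c μ → Periodic (2 ^ α) x → x 0ℤ ≡ 0ℤ →
    (∀ z → +[1+ k ] * conv (2 ^ α) z ≡ c * x z + μ) →
    0ℤ ℤ.< μ → μ ℤ.< +[1+ k ] * (∑< (2 ^ α) x + ∑< (2 ^ α) x) →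
    Classified α
  -- For n = 1 the set X is empty, so 0 < μ < 0.
  classify zero k c μ per x0 eqn 0<μ μ<2κM =
    ⊥-elim (ℤₚ.<⇒≱ 0<μ (ℤₚ.≤-trans (ℤₚ.<⇒≤ μ<2κM) (ℤₚ.≤-reflexive
      (trans (cong (λ a → +[1+ k ] * ((0ℤ + a) + (0ℤ + a))) x0) (ℤₚ.*-zeroʳ +[1+ k ])))))
  classify (suc a) k c μ per x0 eqn 0<μ μ<2κM rewrite 2^suc a with x∈01 (+ (2 ^ a))
  ... | inj₂ x-half = record
    { r = a ; 1≤r = 1≤r ; r<α = ℕₚ.n<1+n a ; periodic = per ; shape = shape ; complement = complement }
    where
    h n : ℕ
    h = 2 ^ a
    n = h ℕ.+ h
    κ s C : ℤ
    κ = +[1+ k ]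
    -- The constants are read off at 0 and h, where x is 0 and 1; this divides the equation by κ
    -- inside ℤ.
    s = conv n 0ℤ
    C = s - conv n (+ h)
    κs : κ * s ≡ μ
    κs = trans (eqn 0ℤ) (trans (cong (λ t → c * t + μ) x0) (ring c μ))
      where
      ring : ∀ c m → c * 0ℤ + m ≡ m
      ring = solve-∀
    eqn₁ : ∀ z → conv n z ≡ s - C * x z
    eqn₁ z = ℤₚ.*-cancelˡ-≡ κ _ _ (begin
      κ * conv n z ≡⟨ eqn z ⟩
      c * x z + μ ≡⟨ ring₁ c (x z) μ ⟩
      μ - (μ - (c * 1ℤ + μ)) * x z ≡⟨ cong (λ t → μ - (μ - (c * t + μ)) * x z) (sym x-half) ⟩
      μ - (μ - (c * x (+ h) + μ)) * x z ≡⟨ cong₂ (λ u v → u - (u - v) * x z) (sym κs) (sym (eqn (+ h))) ⟩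
      κ * s - (κ * s - κ * conv n (+ h)) * x z ≡⟨ ring₂ κ s (conv n (+ h)) (x z) ⟩
      κ * (s - C * x z) ∎)
      where
      open ≡-Reasoning
      ring₁ : ∀ c a m → c * a + m ≡ m - (m - (c * 1ℤ + m)) * a
      ring₁ = solve-∀
      ring₂ : ∀ k s t a → k * s - (k * s - k * t) * a ≡ k * (s - (s - t) * a)
      ring₂ = solve-∀
    open HalfIn a C s per x0 x-half eqn₁
      (ℤₚ.*-cancelˡ-<-nonNeg κ (subst (ℤ._< κ * (∑< n x + ∑< n x)) (sym κs) μ<2κM))
      using (1≤r; shape; complement)
  ... | inj₁ x-half = record
    { r = r ; 1≤r = 1≤r ; r<α = ℕₚ.m≤n⇒m≤1+n r<α ; periodic = periodic ; shape = shape ; complement = complement }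
    where
    h n : ℕ
    h = 2 ^ a
    n = h ℕ.+ h
    κ : ℤ
    κ = +[1+ k ]
    open Equation n k c μ (ℕₚ.≤-trans (ℕₚ.m^n>0 2 a) (ℕₚ.m≤m+n h h)) per x0 eqn using (E≡0⇒period; c<0)
    M≢0 : ∑< n x ≢ 0ℤ
    M≢0 e = ℤₚ.<⇒≱ 0<μ (ℤₚ.≤-trans (ℤₚ.<⇒≤ μ<2κM)
      (ℤₚ.≤-reflexive (trans (cong (λ t → κ * (t + t)) e) (ℤₚ.*-zeroʳ κ))))
    E-half≡0 : E (+ h) ≡ 0ℤ
    E-half≡0 = cong₂ _+_ x-half (trans (sym (per (- + h))) (trans (cong x (ring (+ h))) x-half))
      where
      ring : ∀ h → - h + (h + h) ≡ h
      ring = solve-∀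
    -- Since h is a period of E, it is one of the convolution; because c ≠ 0, the equation recovers
    -- x from the convolution.
    per′ : Periodic h x
    per′ z = ℤₚ.*-cancelˡ-≡ c _ _ {{ℤ.≢-nonZero (ℤₚ.<⇒≢ (c<0 M≢0))}} (∙-cancelʳ μ _ _ (begin
      c * x (z + + h) + μ ≡⟨ sym (eqn (z + + h)) ⟩
      κ * conv n (z + + h) ≡⟨ cong (κ *_) (∑-cong n (λ i → cong (x i *_)
          (trans (cong E (ring z (+ h) i)) (E≡0⇒period (+ h) E-half≡0 (z - i))))) ⟩
      κ * conv n z ≡⟨ eqn z ⟩
      c * x z + μ ∎))
      where
      open ≡-Reasoning
      ring : ∀ z h i → (z + h) - i ≡ h + (z - i)
      ring = solve-∀
    double : ∀ f → Periodic h f → ∑< n f ≡ ∑< h f + ∑< h f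
    double f f-per = trans (∑-split h h f) (+-congˡ (∑< h f) (∑-shift h f (+ h) f-per))
    -- Both halves of the old period contribute equally, so the factor doubles: 1 + (k + (k + 1)) =
    -- 2(k + 1).
    eqn′ : ∀ z → +[1+ k ℕ.+ suc k ] * conv h z ≡ c * x z + μ
    eqn′ z = trans (ring κ (conv h z)) (trans (cong (κ *_) (sym (double (λ i → x i * E (z - i))
      (λ i → cong₂ _*_ (per′ i) (E-reflect-periodic per′ z i))))) (eqn z))
      where
      ring : ∀ k s → (k + k) * s ≡ k * (s + s)
      ring = solve-∀
    μ<2κ′M : μ ℤ.< +[1+ k ℕ.+ suc k ] * (∑< h x + ∑< h x)
    μ<2κ′M = subst (μ ℤ.<_) (trans (cong (λ m → κ * (m + m)) (double x per′)) (ring κ (∑< h x))) μ<2κM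
      where
      ring : ∀ k m → k * ((m + m) + (m + m)) ≡ (k + k) * (m + m)
      ring = solve-∀
    open Classified (classify a (k ℕ.+ suc k) c μ per′ x0 eqn′ 0<μ μ<2κ′M)

-- Subsets of ℤ/m as periodic functions on ℤ

periodic-*ℕ : ∀ {A : Set} {m} (f : ℤ → A) → Periodic m f → ∀ q z → f (z + + (q ℕ.* m)) ≡ f z
periodic-*ℕ f per zero z = cong f (ℤₚ.+-identityʳ z)
periodic-*ℕ {m = m} f per (suc q) z =
  trans (cong f (sym (ℤₚ.+-assoc z (+ m) (+ (q ℕ.* m))))) (trans (periodic-*ℕ f per q (z + + m)) (per z))

periodic-* : ∀ {A : Set} {m} (f : ℤ → A) → Periodic m f → ∀ q z → f (z + q * + m) ≡ f z
periodic-* {m = m} f per (+ q) z = trans (cong (λ w → f (z + w)) (sym (ℤₚ.pos-* q m))) (periodic-*ℕ f per q z)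
periodic-* {m = m} f per -[1+ q ] z = begin
  f (z + -[1+ q ] * + m)                          ≡⟨ sym (periodic-*ℕ f per (suc q) (z + -[1+ q ] * + m)) ⟩
  f (z + -[1+ q ] * + m + + (suc q ℕ.* m))        ≡⟨ cong (λ w → f (z + -[1+ q ] * + m + w)) (ℤₚ.pos-* (suc q) m) ⟩
  f (z + -[1+ q ] * + m + + suc q * + m)          ≡⟨ cong f (cancel z (+ suc q) (+ m)) ⟩
  f z                                             ∎
  where
  open ≡-Reasoning
  cancel : ∀ z q m → z + - q * m + q * m ≡ z
  cancel = solve-∀

-- The difference of two remainders is less than m in absolute value, which forces d = 0.
%ℕ-unique : ∀ {m r r′} d → r < m → r′ < m → + r - + r′ ≡ d * + m → r ≡ r′
%ℕ-unique {m} {r} {r′} d r<m r′<m e = ℤₚ.+-injective (ℤₚ.i-j≡0⇒i≡j (+ r) (+ r′) (trans e (cong (_* + m) d≡0)))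
  where
  small : ℤ.∣ d ∣ ℕ.* m < m
  small = subst (_< m) (trans (cong ℤ.∣_∣ (trans (sym (ℤₚ.m-n≡m⊖n r r′)) e)) (ℤₚ.abs-* d (+ m)))
    (ℕₚ.≤-<-trans (ℤₚ.∣m⊝n∣≤m⊔n r r′) (ℕₚ.⊔-lub r<m r′<m))
  d≡0 : d ≡ 0ℤ
  d≡0 = ℤₚ.∣i∣≡0⇒i≡0 (ℕₚ.n<1⇒n≡0 (ℕₚ.*-cancelʳ-< m ℤ.∣ d ∣ 1 (subst (ℤ.∣ d ∣ ℕ.* m <_) (sym (ℕₚ.*-identityˡ m)) small)))

module _ {m : ℕ} .{{_ : NonZero m}} where

  %ℕ-periodic : ∀ z → (z + + m) %ℕ m ≡ z %ℕ m
  %ℕ-periodic z = %ℕ-unique (1ℤ + z /ℕ m - (z + + m) /ℕ m) (n%ℕd<d (z + + m) m) (n%ℕd<d z m)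
    (ring z (+ ((z + + m) %ℕ m)) (+ (z %ℕ m)) ((z + + m) /ℕ m) (z /ℕ m) (+ m)
      (a≡a%ℕn+[a/ℕn]*n (z + + m) m) (a≡a%ℕn+[a/ℕn]*n z m))
    where
    ring₁ : ∀ r r′ q q′ m → r - r′ ≡ ((r + q * m) - (r′ + q′ * m)) + (q′ - q) * m
    ring₁ = solve-∀
    ring₂ : ∀ z q q′ m → ((z + m) - z) + (q′ - q) * m ≡ (1ℤ + q′ - q) * m
    ring₂ = solve-∀
    ring : ∀ z r r′ q q′ m → z + m ≡ r + q * m → z ≡ r′ + q′ * m → r - r′ ≡ (1ℤ + q′ - q) * m
    ring z r r′ q q′ m e e′ = trans (ring₁ r r′ q q′ m)
      (trans (cong₂ (λ a b → (a - b) + (q′ - q) * m) (sym e) (sym e′)) (ring₂ z q q′ m))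

  red : ℤ → Fin m
  red z = fromℕ< (n%ℕd<d z m)

  periodic-red : ∀ {A : Set} (f : ℤ → A) → Periodic m f → ∀ w z → f (w + + toℕ (red z)) ≡ f (w + z)
  periodic-red f per w z = sym (trans (cong (λ t → f (w + t)) z≡)
    (trans (cong f (sym (ℤₚ.+-assoc w (+ toℕ (red z)) (z /ℕ m * + m)))) (periodic-* f per (z /ℕ m) _)))
    where
    z≡ : z ≡ + toℕ (red z) + z /ℕ m * + m
    z≡ = trans (a≡a%ℕn+[a/ℕn]*n z m) (cong (λ t → + t + z /ℕ m * + m) (sym (Finₚ.toℕ-fromℕ< (n%ℕd<d z m))))

  periodic-red₀ : ∀ {A : Set} (f : ℤ → A) → Periodic m f → ∀ z → f (+ toℕ (red z)) ≡ f z
  periodic-red₀ f per z = trans (cong f (sym (ℤₚ.+-identityˡ (+ toℕ (red z)))))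
    (trans (periodic-red f per 0ℤ z) (cong f (ℤₚ.+-identityˡ z)))

  toℕ-ι : ∀ {k} → k < m → toℕ (ι {m} k) ≡ k
  toℕ-ι {k} k<m = trans (Finₚ.toℕ-fromℕ< (m%n<n k m)) (m<n⇒m%n≡m k<m)

  toℕ-neg : ∀ (i : Fin m) → + (m ℕ.∸ toℕ i) ≡ - + toℕ i + + m
  toℕ-neg i = trans (sym (ℤₚ.⊖-≥ (ℕₚ.<⇒≤ (Finₚ.toℕ<n i)))) (trans (sym (ℤₚ.m-n≡m⊖n m (toℕ i))) (ℤₚ.+-comm (+ m) (- + toℕ i)))

  module _ (X : Subset m) where

    ext : ℤ → Bool
    ext z = lookup X (red z)

    ext-toℕ : ∀ i → ext (+ toℕ i) ≡ lookup X i
    ext-toℕ i = cong (lookup X) (Finₚ.toℕ-injective (toℕ-ι (Finₚ.toℕ<n i)))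

    ext-periodic : Periodic m ext
    ext-periodic z = cong (lookup X) (Finₚ.toℕ-injective
      (trans (Finₚ.toℕ-fromℕ< (n%ℕd<d (z + + m) m)) (trans (%ℕ-periodic z) (sym (Finₚ.toℕ-fromℕ< (n%ℕd<d z m))))))

    ext-neg : ∀ w i → ext (w + + toℕ (-ₘ i)) ≡ ext (w - + toℕ i)
    ext-neg w i = trans (periodic-red ext ext-periodic w (+ (m ℕ.∸ toℕ i)))
      (trans (cong (λ t → ext (w + t)) (toℕ-neg i))
        (trans (cong ext (sym (ℤₚ.+-assoc w (- + toℕ i) (+ m)))) (ext-periodic (w - + toℕ i))))

    lookup-neg : ∀ i → lookup X (-ₘ i) ≡ ext (- + toℕ i)
    lookup-neg i = trans (sym (ext-toℕ (-ₘ i))) (trans (cong ext (sym (ℤₚ.+-identityˡ (+ toℕ (-ₘ i)))))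
      (trans (ext-neg 0ℤ i) (cong ext (ℤₚ.+-identityˡ (- + toℕ i)))))

ind : Bool → ℤ
ind b = if b then 1ℤ else 0ℤ

ind∈01 : ∀ b → ind b ≡ 0ℤ ⊎ ind b ≡ 1ℤ
ind∈01 true  = inj₂ refl
ind∈01 false = inj₁ refl

ind-injective : ∀ {a b} → ind a ≡ ind b → a ≡ b
ind-injective {true}  {true}  _ = refl
ind-injective {false} {false} _ = refl

-- The adjacency matrix of the dihedrant

∑-congFin : ∀ {N} {f g : Fin N → ℤ} → (∀ i → f i ≡ g i) → ∑ f ≡ ∑ g
∑-congFin {zero}  p = refl
∑-congFin {suc N} p = cong₂ _+_ (p zero) (∑-congFin (λ i → p (suc i)))

∑≡∑< : ∀ n f → ∑ {n} (λ i → f (+ toℕ i)) ≡ ∑< n f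
∑≡∑< zero    f = refl
∑≡∑< (suc n) f = trans (+-congˡ (f 0ℤ) (∑≡∑< n (λ z → f (1ℤ + z)))) (sym (∑-front n f))

∑-remQuot : ∀ n (F : D n → ℤ) → ∑ {n ℕ.* 2} (λ v → F (remQuot 2 v)) ≡ ∑ {n} (λ i → F (i , zero) + F (i , suc zero))
∑-remQuot zero    F = refl
∑-remQuot (suc n) F = trans
  (sym (ℤₚ.+-assoc (F (zero , zero)) (F (zero , suc zero)) _))
  (+-congˡ (F (zero , zero) + F (zero , suc zero)) (∑-remQuot n (λ g → F (suc (proj₁ g) , proj₂ g))))

-- The action of a^e on rotation exponents: conjugation by a inverts them.
signed : Fin 2 → ℤ → ℤ
signed zero       z = z
signed (suc zero) z = - z

module Dihedrant {n : ℕ} .{{_ : NonZero n}} (X : Subset n) where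

  x : ℤ → ℤ
  x z = ind (ext X z)

  open Indicator x (λ z → ind∈01 (ext X z)) public

  x-periodic : Periodic n x
  x-periodic z = cong ind (ext-periodic X z)

  M : ℤ
  M = ∑< n x

  A : Mat (n ℕ.* 2)
  A = adjMat (Dih n X X)

  -- The exponent of x in g⁻¹h is the signed difference. The exponent of a only selects between the
  -- two connection sets, which here are both X.
  inS-quotient : ∀ (g h : D n) → inS X X (inv g · h) ≡
    ext X (signed (proj₂ g) (+ toℕ (proj₁ h) - + toℕ (proj₁ g)))
  inS-quotient (i , zero) (j , f) = trans (fiber f) (trans (cong (ext X) (ℤₚ.+-comm (+ toℕ (-ₘ i)) (+ toℕ j))) (ext-neg X (+ toℕ j) i))
    where
    fiber : ∀ f → inS X X ((-ₘ i) +ₘ j , f) ≡ ext X (+ toℕ (-ₘ i) + + toℕ j)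
    fiber zero       = refl
    fiber (suc zero) = refl
  inS-quotient (i , suc zero) (j , f) = trans (fiber f) (trans (ext-neg X (+ toℕ i) j) (cong (ext X) (ring (+ toℕ i) (+ toℕ j))))
    where
    ring : ∀ i j → i - j ≡ - (j - i)
    ring = solve-∀
    fiber : ∀ f → inS X X ((i , suc zero) · (j , f)) ≡ ext X (+ toℕ i + + toℕ (-ₘ j))
    fiber zero       = refl
    fiber (suc zero) = refl

  diff : D n → D n → ℤ
  diff g h = signed (proj₂ g) (+ toℕ (proj₁ h) - + toℕ (proj₁ g))

  A-entry : ∀ u v → A u v ≡ x (diff (remQuot 2 u) (remQuot 2 v))
  A-entry u v = cong ind (inS-quotient (remQuot 2 u) (remQuot 2 v))

  ∑-vertices : (F : D n → ℤ) (f : ℤ → ℤ) → (∀ i → F (i , zero) + F (i , suc zero) ≡ f (+ toℕ i)) →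
    ∑ {n ℕ.* 2} (λ v → F (remQuot 2 v)) ≡ ∑< n f
  ∑-vertices F f p = trans (∑-remQuot n F) (trans (∑-congFin p) (∑≡∑< n f))

  ∑-signed : ∀ e i → ∑< n (λ l → x (signed e (l - i))) ≡ M
  ∑-signed zero i = trans (∑-cong n (λ l → cong x (ℤₚ.+-comm l (- i)))) (∑-shift n x (- i) x-periodic)
  ∑-signed (suc zero) i = trans (∑-cong n (λ l → cong x (ring l i))) (∑-reflect n x i x-periodic)
    where
    ring : ∀ l i → - (l - i) ≡ i - l
    ring = solve-∀

  row-sum : ∀ u w → (A ⊗ Jmat) u w ≡ M + M
  row-sum u w = begin
    ∑ (λ v → A u v * 1ℤ)
      ≡⟨ ∑-congFin (λ v → trans (ℤₚ.*-identityʳ (A u v)) (A-entry u v)) ⟩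
    ∑ {n ℕ.* 2} (λ v → x (diff (remQuot 2 u) (remQuot 2 v)))
      ≡⟨ ∑-vertices (λ h → x (diff (remQuot 2 u) h)) (λ l → f l + f l) (λ _ → refl) ⟩
    ∑< n (λ l → f l + f l) ≡⟨ ∑-+ n f f ⟩
    ∑< n f + ∑< n f        ≡⟨ cong (λ t → t + t) (∑-signed (proj₂ (remQuot {n} 2 u)) (+ toℕ (proj₁ (remQuot {n} 2 u)))) ⟩
    M + M                  ∎
    where
    open ≡-Reasoning
    f : ℤ → ℤ
    f l = x (signed (proj₂ (remQuot {n} 2 u)) (l - + toℕ (proj₁ (remQuot {n} 2 u))))

  -- The two vertices with rotation exponent l contribute x(j - l) and x(l - j), together E(j - l).
  column-sum : ∀ u w → (Jmat ⊗ A) u w ≡ M + M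
  column-sum u w = begin
    ∑ (λ v → 1ℤ * A v w)
      ≡⟨ ∑-congFin (λ v → trans (ℤₚ.*-identityˡ (A v w)) (A-entry v w)) ⟩
    ∑ {n ℕ.* 2} (λ v → x (diff (remQuot 2 v) (remQuot 2 w)))
      ≡⟨ ∑-vertices (λ g → x (diff g (remQuot 2 w))) (λ l → E (j - l)) (λ _ → refl) ⟩
    ∑< n (λ l → E (j - l)) ≡⟨ ∑-reflect n E j (E-periodic x-periodic) ⟩
    ∑< n E                 ≡⟨ ∑E x-periodic ⟩
    M + M                  ∎
    where
    open ≡-Reasoning
    j : ℤ
    j = + toℕ (proj₁ (remQuot {n} 2 w))

  -- Reindexing by a translation for e = 0 and by a reflection for e = 1; in the latter case
  -- evenness of E absorbs the sign.
  conv-signed : ∀ e i j → ∑< n (λ l → x (signed e (l - i)) * E (j - l)) ≡ conv n (signed e (j - i))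
  conv-signed zero i j = trans (sym (∑-shift n f i f-periodic)) (∑-cong n (λ l → cong₂ (λ a b → x a * E b) (ring₁ l i) (ring₂ l i j)))
    where
    f : ℤ → ℤ
    f l = x (l - i) * E (j - l)
    f-periodic : Periodic n f
    f-periodic l = cong₂ _*_ (trans (cong x (ring l (+ n) i)) (x-periodic (l - i))) (E-reflect-periodic x-periodic j l)
      where
      ring : ∀ l n i → (l + n) - i ≡ (l - i) + n
      ring = solve-∀
    ring₁ : ∀ l i → (i + l) - i ≡ l
    ring₁ = solve-∀
    ring₂ : ∀ l i j → j - (i + l) ≡ (j - i) - l
    ring₂ = solve-∀
  conv-signed (suc zero) i j = trans (sym (∑-reflect n f i f-periodic))
    (∑-cong n (λ l → cong₂ _*_ (cong x (ring₁ l i)) (trans (sym (E-even (j - (i - l)))) (cong E (ring₂ l i j)))))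
    where
    f : ℤ → ℤ
    f l = x (- (l - i)) * E (j - l)
    f-periodic : Periodic n f
    f-periodic l = cong₂ _*_ (trans (cong (λ t → x (- t)) (ring l (+ n) i)) (periodic-neg x-periodic (l - i))) (E-reflect-periodic x-periodic j l)
      where
      ring : ∀ l n i → (l + n) - i ≡ (l - i) + n
      ring = solve-∀
    ring₁ : ∀ l i → - ((i - l) - i) ≡ l
    ring₁ = solve-∀
    ring₂ : ∀ l i j → - (j - (i - l)) ≡ - (j - i) - l
    ring₂ = solve-∀

  -- Summing over both intermediate vertices with exponent l turns the second factor into E(j - l),
  -- so A² has the coefficients of XE as its entries.
  A²-entry : ∀ u w → (A ⊗ A) u w ≡ conv n (diff (remQuot 2 u) (remQuot 2 w))
  A²-entry u w = begin
    ∑ (λ v → A u v * A v w) ≡⟨ ∑-congFin (λ v → cong₂ _*_ (A-entry u v) (A-entry v w)) ⟩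
    ∑ {n ℕ.* 2} (λ v → x (diff (remQuot 2 u) (remQuot 2 v)) * x (diff (remQuot 2 v) (remQuot 2 w)))
      ≡⟨ ∑-vertices (λ h → x (diff (remQuot 2 u) h) * x (diff h (remQuot 2 w))) (λ l → x (signed e (l - i)) * E (j - l))
           (λ l → sym (ℤₚ.*-distribˡ-+ (x (signed e (+ toℕ l - i))) (x (j - + toℕ l)) (x (- (j - + toℕ l))))) ⟩
    ∑< n (λ l → x (signed e (l - i)) * E (j - l)) ≡⟨ conv-signed e i j ⟩
    conv n (signed e (j - i)) ∎
    where
    open ≡-Reasoning
    e : Fin 2
    e = proj₂ (remQuot {n} 2 u)
    i j : ℤ
    i = + toℕ (proj₁ (remQuot {n} 2 u))
    j = + toℕ (proj₁ (remQuot {n} 2 w))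

-- Conditions (i) and (ii)

-- Here γ = r + 1, and `ext-H` expresses that X is the preimage of H as an equality of periodic
-- functions.
module Conditions (r : ℕ) {n : ℕ} .{{_ : NonZero n}} (X : Subset n) (H : Subset (2 ^ suc r))
                  (ext-H : ∀ z → ext {{2^≢0 (suc r)}} H z ≡ ext X z) where

  private
    instance
      nonZero : NonZero (2 ^ suc r)
      nonZero = 2^≢0 (suc r)

  open Dihedrant X

  h m : ℕ
  h = 2 ^ r
  m = 2 ^ suc r

  0<h : 0 < h
  0<h = ℕₚ.m^n>0 2 r

  h<m : h < m
  h<m = subst (h <_) (sym (2^suc r)) (ℕₚ.m<m+n h 0<h)

  low<m : ∀ {i} → i < h → i < m
  low<m i<h = ℕₚ.<-trans i<h h<m

  high<m : ∀ {i} → i < h → h ℕ.+ i < m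
  high<m {i} i<h = subst (h ℕ.+ i <_) (sym (2^suc r)) (ℕₚ.+-monoʳ-< h i<h)

  multiplicity : Fin m → ℕ
  multiplicity z = [ not (does (z Fin.≟ 0ᵧ (suc r))) ] ℕ.+ [ does (z Fin.≟ half (suc r)) ]

  toℕ-zero : toℕ (0ᵧ (suc r)) ≡ 0
  toℕ-zero = toℕ-ι (low<m 0<h)

  toℕ-half : toℕ (half (suc r)) ≡ h
  toℕ-half = toℕ-ι h<m

  multiplicity-zero : ∀ z → toℕ z ≡ 0 → multiplicity z ≡ 0
  multiplicity-zero z e = cong₂ (λ a b → [ not a ] ℕ.+ [ b ])
    (dec-true (z Fin.≟ _) (Finₚ.toℕ-injective (trans e (sym toℕ-zero))))
    (dec-false (z Fin.≟ _) λ z≡h → ℕₚ.<⇒≢ 0<h (trans (sym e) (trans (cong toℕ z≡h) toℕ-half)))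

  multiplicity-half : ∀ z → toℕ z ≡ h → multiplicity z ≡ 2
  multiplicity-half z e = cong₂ (λ a b → [ not a ] ℕ.+ [ b ])
    (dec-false (z Fin.≟ _) λ z≡0 → ℕₚ.<⇒≢ 0<h (trans (sym toℕ-zero) (trans (cong toℕ (sym z≡0)) e)))
    (dec-true (z Fin.≟ _) (Finₚ.toℕ-injective (trans e (sym toℕ-half))))

  multiplicity-other : ∀ z → toℕ z ≢ 0 → toℕ z ≢ h → multiplicity z ≡ 1
  multiplicity-other z ≢0 ≢h = cong₂ (λ a b → [ not a ] ℕ.+ [ b ])
    (dec-false (z Fin.≟ _) λ z≡0 → ≢0 (trans (cong toℕ z≡0) toℕ-zero))
    (dec-false (z Fin.≟ _) λ z≡h → ≢h (trans (cong toℕ z≡h) toℕ-half))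

  mult-H+mult-H : ∀ z → + (mult H z ℕ.+ mult H (-ₘ z)) ≡ E (+ toℕ z)
  mult-H+mult-H z = cong₂ _+_
    (trans (pos-[] (lookup H z)) (cong ind (trans (sym (ext-toℕ H z)) (ext-H (+ toℕ z)))))
    (trans (pos-[] (lookup H (-ₘ z))) (cong ind (trans (lookup-neg H z) (ext-H (- + toℕ z)))))
    where
    pos-[] : ∀ b → + [ b ] ≡ ind b
    pos-[] true  = refl
    pos-[] false = refl

  Shape⇒CondI : Shape h → CondI (suc r) H
  Shape⇒CondI shape z = ℤₚ.+-injective (trans (mult-H+mult-H z) E≡multiplicity)
    where
    open Shape shape
    E≡multiplicity : E (+ toℕ z) ≡ + multiplicity z
    E≡multiplicity with ℕₚ.<-cmp (toℕ z) h
    ... | tri≈ _ e _ = trans (cong (λ k → E (+ k)) e) (trans E-half (cong +_ (sym (multiplicity-half z e))))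
    ... | tri< z<h z≢h _ with toℕ z ℕ.≟ 0
    ...   | yes z≡0 = trans (cong (λ k → E (+ k)) z≡0) (trans E-zero (cong +_ (sym (multiplicity-zero z z≡0))))
    ...   | no  z≢0 = trans (E-low (toℕ z) (ℕₚ.n≢0⇒n>0 z≢0) z<h) (cong +_ (sym (multiplicity-other z z≢0 z≢h)))
    E≡multiplicity | tri> _ z≢h h<z = trans (cong (λ k → E (+ k)) z≡) (trans
        (E-high (toℕ z ℕ.∸ h) (ℕₚ.m<n⇒0<n∸m h<z) (ℕₚ.+-cancelˡ-< h _ _ (subst₂ _<_ z≡ (2^suc r) (Finₚ.toℕ<n z))))
        (cong +_ (sym (multiplicity-other z (ℕₚ.m<n⇒n≢0 h<z) z≢h))))
      where
      z≡ : toℕ z ≡ h ℕ.+ (toℕ z ℕ.∸ h)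
      z≡ = sym (ℕₚ.m+[n∸m]≡n (ℕₚ.<⇒≤ h<z))

  CondI⇒Shape : CondI (suc r) H → Shape h
  CondI⇒Shape condI = record
    { E-zero = E≡ (low<m 0<h) (multiplicity-zero (ι 0) (toℕ-ι (low<m 0<h)))
    ; E-half = E≡ h<m (multiplicity-half (ι h) (toℕ-ι h<m))
    ; E-low  = λ i 0<i i<h → E≡ (low<m i<h) (multiplicity-other (ι i)
        (λ e → ℕₚ.<⇒≢ 0<i (trans (sym e) (toℕ-ι (low<m i<h))))
        (λ e → ℕₚ.<⇒≢ i<h (trans (sym (toℕ-ι (low<m i<h))) e)))
    ; E-high = λ i 0<i i<h → E≡ (high<m i<h) (multiplicity-other (ι (h ℕ.+ i))
        (λ e → ℕₚ.<⇒≢ (ℕₚ.≤-trans 0<h (ℕₚ.m≤m+n h i)) (trans (sym e) (toℕ-ι (high<m i<h))))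
        (λ e → ℕₚ.<⇒≢ (ℕₚ.m<m+n h 0<i) (trans (sym e) (toℕ-ι (high<m i<h)))))
    }
    where
    E≡ : ∀ {k c} → k < m → multiplicity (ι k) ≡ c → E (+ k) ≡ + c
    E≡ {k} k<m e = trans (cong (λ j → E (+ j)) (sym (toℕ-ι k<m)))
      (trans (sym (mult-H+mult-H (ι k))) (cong +_ (trans (condI (ι k)) e)))

  lookup-half+ : ∀ z → lookup H (half (suc r) +ₘ z) ≡ ext X (+ h + + toℕ z)
  lookup-half+ z = trans (ext-H (+ toℕ (half (suc r)) + + toℕ z)) (cong (λ k → ext X (+ k + + toℕ z)) toℕ-half)

  complement⇒CondII : (∀ z → x z + x (z - + h) ≡ 1ℤ) → CondII (suc r) H
  complement⇒CondII complement z z∈H h+z∈H = 2≢1 (trans (sym (cong₂ _+_ (cong ind in₁) (cong ind in₂))) (complement (+ h + + toℕ z)))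
    where
    2≢1 : + 2 ≢ 1ℤ
    2≢1 ()
    ring : ∀ h z → (h + z) - h ≡ z
    ring = solve-∀
    in₁ : ext X (+ h + + toℕ z) ≡ true
    in₁ = trans (sym (lookup-half+ z)) ([]=⇒lookup h+z∈H)
    in₂ : ext X (+ h + + toℕ z - + h) ≡ true
    in₂ = trans (cong (ext X) (ring (+ h) (+ toℕ z))) (trans (sym (ext-H (+ toℕ z))) (trans (ext-toℕ H z) ([]=⇒lookup z∈H)))

  m-periodic : Periodic m x
  m-periodic z = cong ind (trans (sym (ext-H (z + + m))) (trans (ext-periodic H z) (ext-H z)))

  CondII⇒disjoint : CondII (suc r) H → ∀ z → x z + x (z - + h) ≢ + 2
  CondII⇒disjoint condII z e with ext X z in p | ext X (z - + h) in q
  CondII⇒disjoint condII z () | false | false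
  CondII⇒disjoint condII z () | false | true
  CondII⇒disjoint condII z () | true  | false
  ... | true | true = condII (red (z - + h))
      (lookup⇒[]= _ H (trans (ext-H (z - + h)) q))
      (lookup⇒[]= _ H (trans (lookup-half+ (red (z - + h))) (trans (sym (ext-H (+ h + + toℕ (red {m} (z - + h)))))
        (trans (periodic-red (ext H) (ext-periodic H) (+ h) (z - + h))
          (trans (ext-H (+ h + (z - + h))) (trans (cong (ext X) (ring (+ h) z)) p))))))
    where
    ring : ∀ h z → h + (z - h) ≡ z
    ring = solve-∀

  hh-periodic : Periodic (h ℕ.+ h) x
  hh-periodic = subst (λ N → Periodic N x) (2^suc r) m-periodic

  -- E - 1 sums to -1 + 1 = 0 over a period, while E sums to 2|X|.
  Shape⇒∑x : Shape h → ∑< (h ℕ.+ h) x ≡ + h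
  Shape⇒∑x shape = ℤₚ.*-cancelˡ-≡ (+ 2) _ _ (begin
    + 2 * S ≡⟨ ring₁ S (+ h) ⟩
    (S + S) + (+ h + + h) * - 1ℤ + + 2 * + h ≡⟨ cong (_+ + 2 * + h) (sym total) ⟩
    ∑< (h ℕ.+ h) (λ i → E i - 1ℤ) + + 2 * + h ≡⟨ cong (_+ + 2 * + h) heads ⟩
    0ℤ + + 2 * + h ≡⟨ ℤₚ.+-identityˡ (+ 2 * + h) ⟩
    + 2 * + h ∎)
    where
    open ≡-Reasoning
    open Shape shape
    S : ℤ
    S = ∑< (h ℕ.+ h) x
    ring₁ : ∀ s h → + 2 * s ≡ (s + s) + (h + h) * - 1ℤ + + 2 * h
    ring₁ = solve-∀
    total : ∑< (h ℕ.+ h) (λ i → E i - 1ℤ) ≡ (S + S) + (+ h + + h) * - 1ℤ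
    total = trans (∑-+ (h ℕ.+ h) E (λ _ → - 1ℤ)) (cong₂ _+_ (∑E hh-periodic) (∑-const (h ℕ.+ h) (- 1ℤ)))
    heads : ∑< (h ℕ.+ h) (λ i → E i - 1ℤ) ≡ 0ℤ
    heads = trans (∑-two-heads h (λ i → E i - 1ℤ) 0<h (λ i p q → cong (_- 1ℤ) (E-low i p q)) (λ i p q → cong (_- 1ℤ) (E-high i p q)))
      (cong₂ (λ a b → (a - 1ℤ) + (b - 1ℤ)) E-zero E-half)

  -- Disjointness makes 1 - x(z) - x(z - h) nonnegative, and its sum over a period is 2h - 2h = 0.
  CondII⇒complement : Shape h → CondII (suc r) H → ∀ z → x z + x (z - + h) ≡ 1ℤ
  CondII⇒complement shape condII z = sym (ℤₚ.i-j≡0⇒i≡j 1ℤ _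
    (∑-nonneg-periodic≤0⇒≡0 (h ℕ.+ h) gap (ℕₚ.≤-trans 0<h (ℕₚ.m≤m+n h h)) gap-periodic gap≥0 (ℤₚ.≤-reflexive ∑gap) z))
    where
    pair gap : ℤ → ℤ
    pair z = x z + x (z - + h)
    gap z = 1ℤ - pair z
    ring₁ : ∀ z n h → (z + n) - h ≡ (z - h) + n
    ring₁ = solve-∀
    shifted-periodic : Periodic (h ℕ.+ h) (λ z → x (z - + h))
    shifted-periodic z = trans (cong x (ring₁ z (+ (h ℕ.+ h)) (+ h))) (hh-periodic (z - + h))
    gap-periodic : Periodic (h ℕ.+ h) gap
    gap-periodic z = cong₂ (λ a b → 1ℤ - (a + b)) (hh-periodic z) (shifted-periodic z)
    gap≥0 : ∀ z → 0ℤ ℤ.≤ gap z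
    gap≥0 z with CondII⇒disjoint condII z | ind∈01 (ext X z) | ind∈01 (ext X (z - + h))
    ... | _  | inj₁ a | inj₁ b rewrite a | b = ℤ.+≤+ z≤n
    ... | _  | inj₁ a | inj₂ b rewrite a | b = ℤ.+≤+ z≤n
    ... | _  | inj₂ a | inj₁ b rewrite a | b = ℤ.+≤+ z≤n
    ... | ≢2 | inj₂ a | inj₂ b = ⊥-elim (≢2 (cong₂ _+_ a b))
    ring₂ : ∀ h → (h + h) * 1ℤ + - 1ℤ * (h + h) ≡ 0ℤ
    ring₂ = solve-∀
    ring₃ : ∀ a → 1ℤ - a ≡ 1ℤ + - 1ℤ * a
    ring₃ = solve-∀
    ∑pair : ∑< (h ℕ.+ h) pair ≡ + h + + h
    ∑pair = trans (∑-+ (h ℕ.+ h) x (λ z → x (z - + h))) (cong₂ _+_ (Shape⇒∑x shape)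
      (trans (∑-cong (h ℕ.+ h) (λ z → cong x (ℤₚ.+-comm z (- + h))))
        (trans (∑-shift (h ℕ.+ h) x (- + h) hh-periodic) (Shape⇒∑x shape))))
    ∑gap : ∑< (h ℕ.+ h) gap ≡ 0ℤ
    ∑gap = trans (∑-cong (h ℕ.+ h) (λ z → ring₃ (pair z)))
      (trans (∑-+ (h ℕ.+ h) (λ _ → 1ℤ) (λ z → - 1ℤ * pair z))
        (trans (cong₂ _+_ (∑-const (h ℕ.+ h) 1ℤ) (trans (∑-*ˡ (h ℕ.+ h) (- 1ℤ) pair) (cong (- 1ℤ *_) ∑pair)))
          (ring₂ (+ h))))

  conv-m : CondI (suc r) H → CondII (suc r) H → ∀ z → conv m z ≡ (1ℤ + + h) - + 2 * x z
  conv-m condI condII z = begin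
    conv m z ≡⟨ cong (λ N → conv N z) (2^suc r) ⟩
    conv (h ℕ.+ h) z ≡⟨ conv-Shape h 0<h hh-periodic shape z ⟩
    ∑< (h ℕ.+ h) x + (x (z - + h) - x z) ≡⟨ cong (_+ (x (z - + h) - x z)) (Shape⇒∑x shape) ⟩
    + h + (x (z - + h) - x z) ≡⟨ ring (+ h) (x z) (x (z - + h)) ⟩
    (x z + x (z - + h)) + + h - + 2 * x z ≡⟨ cong (λ t → t + + h - + 2 * x z) (CondII⇒complement shape condII z) ⟩
    (1ℤ + + h) - + 2 * x z ∎
    where
    open ≡-Reasoning
    shape : Shape h
    shape = CondI⇒Shape condI
    ring : ∀ h a b → h + (b - a) ≡ (a + b) + h - + 2 * a
    ring = solve-∀

-- From the DSRG equation to conditions (i) and (ii)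

module FromDSRG (α : ℕ) (X : Subset (2 ^ α)) (0∉X : ι {{2^≢0 α}} 0 ∉ X)
                (k μ lam t : ℕ) (dsrg : IsDSRGWith (2 ^ α ℕ.* 2) (Dih (2 ^ α) {{2^≢0 α}} X X) k μ lam t) where

  private
    instance
      nonZero : NonZero (2 ^ α)
      nonZero = 2^≢0 α

  open IsDSRGWith dsrg
  open Dihedrant X

  n : ℕ
  n = 2 ^ α

  x0 : x 0ℤ ≡ 0ℤ
  x0 with lookup X (ι 0) in e
  ... | false = refl
  ... | true  = ⊥-elim (0∉X (lookup⇒[]= (ι 0) X e))

  -- The vertex of the identity element; `diff` from it is the rotation exponent of the other
  -- vertex.
  u : Fin (n ℕ.* 2)
  u = combine (ι 0) zero

  diff-u : ∀ j f → diff (remQuot 2 u) (remQuot 2 (combine j f)) ≡ + toℕ j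
  diff-u j f = trans (cong₂ diff (Finₚ.remQuot-combine {n} (ι 0) zero) (Finₚ.remQuot-combine {n} j f))
    (trans (cong (λ i → + toℕ j - + i) (toℕ-ι (ℕₚ.m^n>0 2 α))) (ℤₚ.+-identityʳ (+ toℕ j)))

  A²-from-u : ∀ j f → conv n (+ toℕ j) ≡
    + t * Imat u (combine j f) + + lam * x (+ toℕ j) + + μ * (1ℤ - Imat u (combine j f) - x (+ toℕ j))
  A²-from-u j f = trans (cong (conv n) (sym (diff-u j f))) (trans (sym (A²-entry u w)) (trans (A²≡ u w)
    (cong (λ a → + t * Imat u w + + lam * a + + μ * (1ℤ - Imat u w - a)) (trans (A-entry u w) (cong x (diff-u j f))))))
    where
    w : Fin (n ℕ.* 2)
    w = combine j f

  -- Read off at the reflection with exponent j: it differs from the identity, so the term with t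
  -- drops out.
  conv-toℕ : ∀ j → conv n (+ toℕ j) ≡ (+ lam - + μ) * x (+ toℕ j) + + μ
  conv-toℕ j = trans (A²-from-u j (suc zero)) (trans
      (cong (λ b → + t * ind b + + lam * x (+ toℕ j) + + μ * (1ℤ - ind b - x (+ toℕ j)))
        (dec-false (u Fin.≟ combine j (suc zero)) λ e → 0≢1 (Finₚ.combine-injectiveʳ (ι 0) zero j (suc zero) e)))
      (ring (+ t) (+ lam) (+ μ) (x (+ toℕ j))))
    where
    0≢1 : _≢_ {A = Fin 2} zero (suc zero)
    0≢1 ()
    ring : ∀ t l m a → t * 0ℤ + l * a + m * (1ℤ - 0ℤ - a) ≡ (l - m) * a + m
    ring = solve-∀

  conv-periodic : Periodic n (conv n)
  conv-periodic z = ∑-cong n (λ i → cong (x i *_) (trans (cong E (ring z (+ n) i)) (E-periodic x-periodic (z - i))))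
    where
    ring : ∀ z n i → (z + n) - i ≡ (z - i) + n
    ring = solve-∀

  conv-eqn : ∀ z → 1ℤ * conv n z ≡ (+ lam - + μ) * x z + + μ
  conv-eqn z = trans (ℤₚ.*-identityˡ (conv n z)) (trans (sym (periodic-red₀ (conv n) conv-periodic z))
    (trans (conv-toℕ (red z)) (cong (λ a → (+ lam - + μ) * a + + μ) (periodic-red₀ x x-periodic z))))

  -- The entries of A² from the identity to itself and to a are the same convolution value; the
  -- first equals t, the second μ.
  t≡μ : t ≡ μ
  t≡μ = ℤₚ.+-injective (begin
    + t ≡⟨ ring₁ (+ t) (+ lam) (+ μ) ⟩
    + t * 1ℤ + + lam * 0ℤ + + μ * (1ℤ - 1ℤ - 0ℤ)
      ≡⟨ cong₂ (λ b a → + t * ind b + + lam * a + + μ * (1ℤ - ind b - a)) (sym (dec-true (u Fin.≟ u) refl)) (sym xι0) ⟩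
    _ ≡⟨ sym (A²-from-u (ι 0) zero) ⟩
    conv n (+ toℕ (ι {n} 0)) ≡⟨ conv-toℕ (ι 0) ⟩
    (+ lam - + μ) * x (+ toℕ (ι {n} 0)) + + μ ≡⟨ cong (λ a → (+ lam - + μ) * a + + μ) xι0 ⟩
    (+ lam - + μ) * 0ℤ + + μ ≡⟨ ring₂ (+ lam) (+ μ) ⟩
    + μ ∎)
    where
    open ≡-Reasoning
    xι0 : x (+ toℕ (ι {n} 0)) ≡ 0ℤ
    xι0 = trans (periodic-red₀ x x-periodic 0ℤ) x0
    ring₁ : ∀ t l m → t ≡ t * 1ℤ + l * 0ℤ + m * (1ℤ - 1ℤ - 0ℤ)
    ring₁ = solve-∀
    ring₂ : ∀ l m → (l - m) * 0ℤ + m ≡ m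
    ring₂ = solve-∀

  classified : Classified α
  classified = classify α 0 (+ lam - + μ) (+ μ) x-periodic x0 conv-eqn
    -- Genuineness supplies both bounds: 0 < t = μ, and μ = t < k = 2|X|.
    (ℤ.+<+ (subst (0 <_) t≡μ 0<t))
    (subst (+ μ ℤ.<_) (sym (trans (ℤₚ.*-identityˡ (M + M)) (trans (sym (row-sum u u)) (trans (AJ≡kJ u u) (ℤₚ.*-identityʳ (+ k))))))
      (ℤ.+<+ (subst (_< k) t≡μ t<k)))

  open Classified classified

  H : Subset (2 ^ suc r)
  H = tabulate (λ j → ext X (+ toℕ j))

  ext-X-periodic : Periodic (2 ^ suc r) (ext X)
  ext-X-periodic = subst (λ N → Periodic N (ext X)) (sym (2^suc r)) (λ z → ind-injective (periodic z))

  ext-H : ∀ z → ext {{2^≢0 (suc r)}} H z ≡ ext X z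
  ext-H z = trans (lookup∘tabulate (λ j → ext X (+ toℕ j)) (red {{2^≢0 (suc r)}} z))
    (periodic-red₀ {{2^≢0 (suc r)}} (ext X) ext-X-periodic z)

  ∈X⇔ψ∈H : ∀ i → i ∈ X ⇔ ψ {α} (suc r) i ∈ H
  ∈X⇔ψ∈H i = mk⇔
    (λ i∈X → lookup⇒[]= _ H (trans same ([]=⇒lookup i∈X)))
    (λ ψi∈H → lookup⇒[]= i X (trans (sym same) ([]=⇒lookup ψi∈H)))
    where
    same : lookup H (ψ {α} (suc r) i) ≡ lookup X i
    same = trans (ext-H (+ toℕ i)) (ext-toℕ X i)

  open Conditions r X H ext-H using (Shape⇒CondI; complement⇒CondII)

  preimage : ∃[ γ ] (2 ≤ γ × γ ≤ α × ∃[ H ] ((∀ i → (i ∈ X ⇔ ψ {α} γ i ∈ H)) × CondI γ H × CondII γ H))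
  preimage = suc r , s≤s 1≤r , r<α , H , ∈X⇔ψ∈H , Shape⇒CondI shape , complement⇒CondII complement

-- From conditions (i) and (ii) to the DSRG equation

module ToDSRG (α r : ℕ) (1≤r : 1 ≤ r) (r<α : suc r ≤ α) (X : Subset (2 ^ α)) (H : Subset (2 ^ suc r))
              (∈X⇔ψ∈H : ∀ i → i ∈ X ⇔ ψ {α} (suc r) i ∈ H)
              (condI : CondI (suc r) H) (condII : CondII (suc r) H) where

  private
    instance
      nonZero : NonZero (2 ^ α)
      nonZero = 2^≢0 α

  open Dihedrant X

  -- κ is the size of each fibre of the reduction from ℤ/n to ℤ/m.
  κ h m n : ℕ
  κ = 2 ^ (α ℕ.∸ suc r)
  h = 2 ^ r
  m = 2 ^ suc r
  n = 2 ^ α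

  n≡κm : n ≡ κ ℕ.* m
  n≡κm = trans (cong (2 ^_) (sym (ℕₚ.m∸n+n≡m r<α))) (ℕₚ.^-distribˡ-+-* 2 (α ℕ.∸ suc r) (suc r))

  ext-H : ∀ z → ext {{2^≢0 (suc r)}} H z ≡ ext X z
  ext-H z = trans (sym (periodic-red₀ (ext {{2^≢0 (suc r)}} H) n-periodic z)) (same (red z))
    where
    n-periodic : Periodic n (ext {{2^≢0 (suc r)}} H)
    n-periodic = subst (λ N → Periodic N (ext {{2^≢0 (suc r)}} H)) (sym n≡κm)
      (periodic-*ℕ (ext {{2^≢0 (suc r)}} H) (ext-periodic {{2^≢0 (suc r)}} H) κ)
    ⇔⇒≡ : ∀ {a b} → (a ≡ true → b ≡ true) → (b ≡ true → a ≡ true) → a ≡ b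
    ⇔⇒≡ {true}  {_}     f g = sym (f refl)
    ⇔⇒≡ {false} {true}  f g = g refl
    ⇔⇒≡ {false} {false} f g = refl
    same : ∀ i → lookup H (ψ {α} (suc r) i) ≡ lookup X i
    same i = ⇔⇒≡
      (λ e → []=⇒lookup (Equivalence.from (∈X⇔ψ∈H i) (lookup⇒[]= _ H e)))
      (λ e → []=⇒lookup (Equivalence.to (∈X⇔ψ∈H i) (lookup⇒[]= i X e)))

  open Conditions r X H ext-H using (m-periodic; conv-m; CondI⇒Shape; Shape⇒∑x)

  κ-fold : ∀ f → Periodic m f → ∑< n f ≡ + κ * ∑< m f
  κ-fold f per = trans (cong (λ N → ∑< N f) n≡κm) (∑-mult κ m f per)

  conv-n : ∀ z → conv n z ≡ + κ * ((1ℤ + + h) - + 2 * x z)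
  conv-n z = trans (κ-fold (λ i → x i * E (z - i)) (λ i → cong₂ _*_ (m-periodic i) (E-reflect-periodic m-periodic z i)))
    (cong (+ κ *_) (conv-m condI condII z))

  degree : M + M ≡ + (κ ℕ.* (h ℕ.+ h))
  degree = begin
    M + M ≡⟨ cong (λ s → s + s) (κ-fold x m-periodic) ⟩
    + κ * ∑< m x + + κ * ∑< m x ≡⟨ cong (λ s → + κ * s + + κ * s) (trans (cong (λ N → ∑< N x) (2^suc r)) (Shape⇒∑x (CondI⇒Shape condI))) ⟩
    + κ * + h + + κ * + h ≡⟨ sym (ℤₚ.*-distribˡ-+ (+ κ) (+ h) (+ h)) ⟩
    + κ * (+ h + + h) ≡⟨ sym (ℤₚ.pos-* κ (h ℕ.+ h)) ⟩
    + (κ ℕ.* (h ℕ.+ h)) ∎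
    where open ≡-Reasoning

  0<κ : 0 < κ
  0<κ = ℕₚ.m^n>0 2 (α ℕ.∸ suc r)

  1<h : 1 < h
  1<h = ℕₚ.^-monoʳ-≤ 2 1≤r

  -- The parameters are t = μ = κ(h + 1) and λ = κ(h - 1). The number b stands for an entry of the
  -- identity matrix and cancels because t = μ.
  A²-eqn : ∀ z b → conv n z ≡ + (κ ℕ.* suc h) * b + + (κ ℕ.* ℕ.pred h) * x z + + (κ ℕ.* suc h) * (1ℤ - b - x z)
  A²-eqn z b = begin
    conv n z ≡⟨ conv-n z ⟩
    + κ * ((1ℤ + + h) - + 2 * x z) ≡⟨ cong (λ k → + κ * ((1ℤ + + k) - + 2 * x z)) (sym h≡) ⟩
    + κ * ((1ℤ + (1ℤ + + ℕ.pred h)) - + 2 * x z) ≡⟨ ring (+ κ) (+ ℕ.pred h) (x z) b ⟩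
    + κ * (1ℤ + (1ℤ + + ℕ.pred h)) * b + + κ * + ℕ.pred h * x z + + κ * (1ℤ + (1ℤ + + ℕ.pred h)) * (1ℤ - b - x z)
      ≡⟨ cong (λ k → + κ * (1ℤ + + k) * b + + κ * + ℕ.pred h * x z + + κ * (1ℤ + + k) * (1ℤ - b - x z)) h≡ ⟩
    + κ * + suc h * b + + κ * + ℕ.pred h * x z + + κ * + suc h * (1ℤ - b - x z)
      ≡⟨ cong₂ (λ t l → t * b + l * x z + t * (1ℤ - b - x z)) (sym (ℤₚ.pos-* κ (suc h))) (sym (ℤₚ.pos-* κ (ℕ.pred h))) ⟩
    _ ∎
    where
    open ≡-Reasoning
    h≡ : suc (ℕ.pred h) ≡ h
    h≡ = ℕₚ.suc-pred h {{2^≢0 r}}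
    ring : ∀ k p a b → k * ((1ℤ + (1ℤ + p)) - + 2 * a) ≡
      k * (1ℤ + (1ℤ + p)) * b + k * p * a + k * (1ℤ + (1ℤ + p)) * (1ℤ - b - a)
    ring = solve-∀

  dsrg : IsDSRG (Dih n X X)
  dsrg = κ ℕ.* (h ℕ.+ h) , κ ℕ.* suc h , κ ℕ.* ℕ.pred h , κ ℕ.* suc h , record
    { AJ≡kJ = λ u w → trans (row-sum u w) (trans degree (sym (ℤₚ.*-identityʳ _)))
    ; JA≡kJ = λ u w → trans (column-sum u w) (trans degree (sym (ℤₚ.*-identityʳ _)))
    ; A²≡   = λ u w → trans (A²-entry u w) (trans (A²-eqn (diff (remQuot 2 u) (remQuot 2 w)) (Imat u w))
        (cong (λ a → + (κ ℕ.* suc h) * Imat u w + + (κ ℕ.* ℕ.pred h) * a + + (κ ℕ.* suc h) * (1ℤ - Imat u w - a))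
          (sym (A-entry u w))))
    ; 0<t   = ℕₚ.*-mono-≤ 0<κ (s≤s z≤n)
    -- κ(1 + h) < κ(h + h) by 1 < h, which comes from γ ≥ 2.
    ; t<k   = ℕₚ.*-monoʳ-< κ {{2^≢0 (α ℕ.∸ suc r)}} (ℕₚ.+-monoˡ-< h 1<h)
    }

theorem6p3 : (α : ℕ) → 1 ≤ α → (X : Subset (2 ^ α)) →
    ι {{2^≢0 α}} 0 ∉ X →
    (IsDSRG (Dih (2 ^ α) {{2^≢0 α}} X X)
    ⇔ (∃[ γ ] (2 ≤ γ × γ ≤ α × ∃[ H ] ((∀ i → (i ∈ X ⇔ ψ {α} γ i ∈ H)) × CondI γ H × CondII γ H))))
theorem6p3 α _ X 0∉X = mk⇔
  (λ { (k , μ , lam , t , dsrg) → FromDSRG.preimage α X 0∉X k μ lam t dsrg })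
  (λ { (suc r , s≤s 1≤r , γ≤α , H , ∈X⇔ψ∈H , condI , condII) → ToDSRG.dsrg α r 1≤r γ≤α X H ∈X⇔ψ∈H condI condII })
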